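{- For all $m,k\in\mathbb{N}$, $$\sum_{n=1}^\infty\frac{4^n}{\binom{2n}{n}}\frac{\zeta_{n-1}(1_{m-1})t^\star_n(1_k)}{n^2}=\sum_{n=1}^\infty\frac{1}{4^n}\binom{2n}{n}\frac{t_n(1_k)\zeta^\star_n(1_m)}{n}=\binom{m+k}{k}\frac{2^{m+k+1}-1}{2^k}\zeta(m+k+1).$$ Moreover, for $m=0$ and $k\in\mathbb{N}$ the second equality also holds: $\sum_{n=1}^\infty\frac{1}{4^n}\binom{2n}{n}\frac{t_n(1_k)}{n}=\frac{2^{k+1}-1}{2^k}\zeta(k+1)$.
   Context: For $n\in\mathbb{N}_0$: $\zeta_n(1_d)=\sum_{n\ge n_1>\cdots>n_d>0}\prod n_j^{ -1}$, $\zeta^\star_n(1_d)=\sum_{n\ge n_1\ge\cdots\ge n_d>0}\prod n_j^{ -1}$, $t_n(1_d)=\sum_{n\ge n_1>\cdots>n_d>0}\prod(2n_j-1)^{ -1}$, $t^\star_n(1_d)=\sum_{n\ge n_1\ge\cdots\ge n_d>0}\prod(2n_j-1)^{ -1}$, all equal to $1$ for $d=0$; $1_d$ is the string of $d$ ones. -}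

module Defs where

open import Data.Nat as ℕ using (ℕ; zero; suc; _∸_)
open import Data.Nat.Combinatorics using (_C_)
open import Data.Integer using (+_)
open import Data.Rational using (ℚ; 0ℚ; 1ℚ; _+_; _*_; _-_; _/_; ∣_∣; _<_)
open import Data.Product using (∃; _×_)

ℕ→ℚ : ℕ → ℚ
ℕ→ℚ n = + n / 1

-- 1/n for n ≥ 1 (only ever applied to positive arguments; 1/0 := 0 is a junk value)
inv : ℕ → ℚ
inv zero    = 0ℚ
inv (suc n) = + 1 / suc n

Σ1 : ℕ → (ℕ → ℚ) → ℚ
Σ1 zero    f = 0ℚ
Σ1 (suc n) f = Σ1 n f + f (suc n)

-- ζ_n(1_d) = Σ_{n ≥ n1 > ... > nd > 0} Π 1/nj  (recursively: first index j, rest < j)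
ζₙ : ℕ → ℕ → ℚ
ζₙ zero    n = 1ℚ
ζₙ (suc d) n = Σ1 n (λ j → inv j * ζₙ d (j ∸ 1))

ζ⋆ₙ : ℕ → ℕ → ℚ
ζ⋆ₙ zero    n = 1ℚ
ζ⋆ₙ (suc d) n = Σ1 n (λ j → inv j * ζ⋆ₙ d j)

tₙ : ℕ → ℕ → ℚ
tₙ zero    n = 1ℚ
tₙ (suc d) n = Σ1 n (λ j → inv (2 ℕ.* j ∸ 1) * tₙ d (j ∸ 1))

t⋆ₙ : ℕ → ℕ → ℚ
t⋆ₙ zero    n = 1ℚ
t⋆ₙ (suc d) n = Σ1 n (λ j → inv (2 ℕ.* j ∸ 1) * t⋆ₙ d j)

ζpartial : ℕ → ℕ → ℚ
ζpartial s N = Σ1 N (λ n → inv (n ℕ.^ s))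

-- "Σ_{n≥1} a n = c · ζ(s)"  (for s ≥ 2), expressed in ℚ:
-- the partial sums of a minus c times the partial sums of ζ(s) tend to 0.
-- Since Σ 1/n^s converges for s ≥ 2, this is equivalent to the real-valued identity
-- (including convergence of the left-hand series).
SeriesEqζ : (ℕ → ℚ) → ℚ → ℕ → Set
SeriesEqζ a c s =
  ∀ (ε : ℚ) → 0ℚ < ε → ∃ λ N → ∀ M → N ℕ.≤ M →
    ∣ Σ1 M a - c * ζpartial s M ∣ < ε

{-# OPTIONS --safe #-}
module Submission where

open import Defs

-- Write (x)_n for the rising factorial. Both series are coefficients of Σ_n (b)_n / (n (g)_n): the first is that of
-- x^k y^m for b = y, g = (1 − x)/2, the second for b = (1 + x)/2, g = 1 − y. In both cases g − b = 1/2 − x/2 − y.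
-- The pair F(n,i) = (b)_n / (n (g+i)_n), G(n,i) = (b)_n / ((g+i)_n (g+i−b)) satisfies
-- F(n,i) − F(n,i+1) = G(n,i) − G(n+1,i), so summing over n and i turns the series into
-- Σ_i G(1,i) = Σ_i (1/(g+i−b) − 1/(g+i)). The coefficient of x^k y^m in 1/(g+i−b) = 1/(i + 1/2 − x/2 − y) is
-- C(m+k,k) 2^{−k} (i + 1/2)^{−m−k−1}, and that in 1/(g+i) vanishes for the exponents in question. The sum of the
-- odd terms is then a multiple of ζ(m+k+1). All coefficients are nonnegative, which makes the boundary terms easy to bound.

-- Everything stays in ℚ. An identity of generating functions is stated as a recurrence for
-- coefficients in the indices `u`, `v`, with multiplication by a variable becoming the shift `sh`.
-- Division by a series such as 1/2 + i - aX - cY then means cancelling its positive constant term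
-- and inducting on the lower coefficients. Infinite sums are never interchanged: the telescoping
-- runs over a finite N × N square, and two edges remain. On the edge i = N the terms F(n,N) are
-- compared with a series whose partial sums stay below its value. On the edge n = N + 1 the terms
-- G(N+1,i) are controlled by (b)_N / (g)_N, which has to tend to 0. That last limit is the analytic
-- obstacle. The constant term decays like a power of N because g - b has constant term 1/2, but
-- Gamma asymptotics are avoided. A recurrence with the gap 1/2 between its two factors is compared
-- with a harmonic sum, whose divergence suffices; the higher coefficients follow because the lower
-- ones enter only as null perturbations.

module RationalSeries where

  open import Data.Nat as ℕ using (ℕ; zero; suc; _∸_; _^_; _!)
  import Data.Nat.Properties as ℕₚ
  open import Data.Nat.DivMod using (m/n*n≡m)
  open import Data.Nat.Combinatorics using (_C_; nCn≡1; nCk≡nC[n∸k]; nCk+nC[k+1]≡[n+1]C[k+1]; nCk≡n!/k![n-k]!; k![n∸k]!∣n!)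
  open import Data.Integer as ℤ using (-[1+_]; +[1+_]) renaming (+_ to pos)
  import Data.Integer.Properties as ℤₚ
  open import Data.Rational using (ℚ; mkℚ; 0ℚ; 1ℚ; ½; _+_; _*_; _-_; -_; ∣_∣; _≤_; _<_; toℚᵘ; *<*; positive; nonNegative)
  open import Data.Rational.Properties
  import Data.Rational.Unnormalised as ℚᵘ
  import Data.Rational.Unnormalised.Properties as ℚᵘₚ
  open import Data.Product using (∃; _,_)
  open import Data.Sum using (_⊎_; inj₁; inj₂)
  open import Function using (_∘_)
  open import Level using (0ℓ)
  open import Relation.Nullary.Decidable using (dec⇒maybe; from-yes)
  open import Relation.Binary.PropositionalEquality
  open import Tactic.RingSolver using (solve-∀)
  open import Tactic.RingSolver.Core.AlmostCommutativeRing using (AlmostCommutativeRing; fromCommutativeRing)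

  ring : AlmostCommutativeRing 0ℓ 0ℓ
  ring = fromCommutativeRing +-*-commutativeRing (λ x → dec⇒maybe (0ℚ ≟ x))

  ι : ℕ → ℚ
  ι = ℕ→ℚ

  -- Order

  0≤1 : 0ℚ ≤ 1ℚ
  0≤1 = from-yes (0ℚ ≤? 1ℚ)

  0≤½ : 0ℚ ≤ ½
  0≤½ = from-yes (0ℚ ≤? ½)

  0<½ : 0ℚ < ½
  0<½ = from-yes (0ℚ <? ½)

  +-nonNeg : ∀ {x y} → 0ℚ ≤ x → 0ℚ ≤ y → 0ℚ ≤ x + y
  +-nonNeg = +-mono-≤

  *-monoˡ : ∀ {c x y} → 0ℚ ≤ c → x ≤ y → c * x ≤ c * y
  *-monoˡ {c} 0≤c = *-monoˡ-≤-nonNeg c {{nonNegative 0≤c}}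

  *-monoʳ : ∀ {c x y} → 0ℚ ≤ c → x ≤ y → x * c ≤ y * c
  *-monoʳ {c} 0≤c = *-monoʳ-≤-nonNeg c {{nonNegative 0≤c}}

  *-nonNeg : ∀ {x y} → 0ℚ ≤ x → 0ℚ ≤ y → 0ℚ ≤ x * y
  *-nonNeg {x} {y} 0≤x 0≤y = subst (_≤ x * y) (*-zeroʳ x) (*-monoˡ 0≤x 0≤y)

  *-pos : ∀ {x y} → 0ℚ < x → 0ℚ < y → 0ℚ < x * y
  *-pos {x} {y} 0<x 0<y = subst (_< x * y) (*-zeroʳ x) (*-monoʳ-<-pos x {{positive 0<x}} 0<y)

  *-cancel-≤ : ∀ {c x y} → 0ℚ < c → c * x ≤ c * y → x ≤ y
  *-cancel-≤ {c} 0<c = *-cancelˡ-≤-pos c {{positive 0<c}}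

  *-cancel-≡ : ∀ {c x y} → 0ℚ < c → c * x ≡ c * y → x ≡ y
  *-cancel-≡ 0<c eq = ≤-antisym (*-cancel-≤ 0<c (≤-reflexive eq)) (*-cancel-≤ 0<c (≤-reflexive (sym eq)))

  ≤-by : ∀ {x y} d → 0ℚ ≤ d → y ≡ x + d → x ≤ y
  ≤-by {x} d 0≤d eq = subst₂ _≤_ (+-identityʳ x) (sym eq) (+-monoʳ-≤ x 0≤d)

  -- Natural numbers and their reciprocals as rationals

  private
    toℚᵘ-ι : ∀ n → toℚᵘ (ι n) ℚᵘ.≃ ℚᵘ.mkℚᵘ (pos n) 0
    toℚᵘ-ι n = toℚᵘ-fromℚᵘ (ℚᵘ.mkℚᵘ (pos n) 0)

    toℚᵘ-inv : ∀ n → toℚᵘ (inv (suc n)) ℚᵘ.≃ ℚᵘ.mkℚᵘ (pos 1) n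
    toℚᵘ-inv n = toℚᵘ-fromℚᵘ (ℚᵘ.mkℚᵘ (pos 1) n)

  ι-+ : ∀ m n → ι (m ℕ.+ n) ≡ ι m + ι n
  ι-+ m n = toℚᵘ-injective (begin
    toℚᵘ (ι (m ℕ.+ n))                    ≈⟨ toℚᵘ-ι (m ℕ.+ n) ⟩
    ℚᵘ.mkℚᵘ (pos (m ℕ.+ n)) 0               ≈⟨ ℚᵘ.*≡* (cong (ℤ._* pos 1) (sym (cong₂ ℤ._+_ (ℤₚ.*-identityʳ (pos m)) (ℤₚ.*-identityʳ (pos n))))) ⟩
    ℚᵘ.mkℚᵘ (pos m) 0 ℚᵘ.+ ℚᵘ.mkℚᵘ (pos n) 0  ≈⟨ ℚᵘₚ.+-cong (toℚᵘ-ι m) (toℚᵘ-ι n) ⟨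
    toℚᵘ (ι m) ℚᵘ.+ toℚᵘ (ι n)            ≈⟨ toℚᵘ-homo-+ (ι m) (ι n) ⟨
    toℚᵘ (ι m + ι n)                      ∎)
    where open ℚᵘₚ.≃-Reasoning

  ι-* : ∀ m n → ι (m ℕ.* n) ≡ ι m * ι n
  ι-* m n = toℚᵘ-injective (begin
    toℚᵘ (ι (m ℕ.* n))                    ≈⟨ toℚᵘ-ι (m ℕ.* n) ⟩
    ℚᵘ.mkℚᵘ (pos (m ℕ.* n)) 0               ≈⟨ ℚᵘ.*≡* (cong (ℤ._* pos 1) (ℤₚ.pos-* m n)) ⟩
    ℚᵘ.mkℚᵘ (pos m) 0 ℚᵘ.* ℚᵘ.mkℚᵘ (pos n) 0  ≈⟨ ℚᵘₚ.*-cong (toℚᵘ-ι m) (toℚᵘ-ι n) ⟨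
    toℚᵘ (ι m) ℚᵘ.* toℚᵘ (ι n)            ≈⟨ toℚᵘ-homo-* (ι m) (ι n) ⟨
    toℚᵘ (ι m * ι n)                      ∎)
    where open ℚᵘₚ.≃-Reasoning

  ι-suc : ∀ n → ι (suc n) ≡ 1ℚ + ι n
  ι-suc = ι-+ 1

  ι*inv : ∀ n → ι (suc n) * inv (suc n) ≡ 1ℚ
  ι*inv n = toℚᵘ-injective (begin
    toℚᵘ (ι (suc n) * inv (suc n))              ≈⟨ toℚᵘ-homo-* (ι (suc n)) (inv (suc n)) ⟩
    toℚᵘ (ι (suc n)) ℚᵘ.* toℚᵘ (inv (suc n))    ≈⟨ ℚᵘₚ.*-cong (toℚᵘ-ι (suc n)) (toℚᵘ-inv n) ⟩
    ℚᵘ.mkℚᵘ (pos (suc n)) 0 ℚᵘ.* ℚᵘ.mkℚᵘ (pos 1) n    ≈⟨ ℚᵘ.*≡* (cong pos (trans (ℕₚ.*-identityʳ _) (trans (ℕₚ.*-identityʳ (suc n)) (sym (trans (ℕₚ.*-identityˡ _) (ℕₚ.*-identityˡ (suc n))))))) ⟩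
    ℚᵘ.mkℚᵘ (pos 1) 0                             ≡⟨⟩
    toℚᵘ 1ℚ                                     ∎)
    where open ℚᵘₚ.≃-Reasoning

  0≤ι : ∀ n → 0ℚ ≤ ι n
  0≤ι n = nonNegative⁻¹ (ι n) {{normalize-nonNeg n 1}}

  0<ι : ∀ n → 0ℚ < ι (suc n)
  0<ι n = positive⁻¹ (ι (suc n)) {{normalize-pos (suc n) 1}}

  0≤inv : ∀ n → 0ℚ ≤ inv n
  0≤inv zero    = ≤-refl
  0≤inv (suc n) = nonNegative⁻¹ (inv (suc n)) {{normalize-nonNeg 1 (suc n)}}

  0<inv : ∀ n → 0ℚ < inv (suc n)
  0<inv n = positive⁻¹ (inv (suc n)) {{normalize-pos 1 (suc n)}}

  ι-mono : ∀ {m n} → m ℕ.≤ n → ι m ≤ ι n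
  ι-mono {m} {n} m≤n = ≤-by (ι (n ∸ m)) (0≤ι (n ∸ m)) (trans (cong ι (sym (ℕₚ.m+[n∸m]≡n m≤n))) (ι-+ m (n ∸ m)))

  inv-unique : ∀ n {x} → ι (suc n) * x ≡ 1ℚ → x ≡ inv (suc n)
  inv-unique n eq = *-cancel-≡ (0<ι n) (trans eq (sym (ι*inv n)))

  inv-* : ∀ m n → inv (m ℕ.* n) ≡ inv m * inv n
  -- The default value `inv 0 = 0` settles the two cases with a zero factor.
  inv-* zero    n       = sym (*-zeroˡ (inv n))
  inv-* (suc m) zero    = trans (cong inv (ℕₚ.*-zeroʳ m)) (sym (*-zeroʳ (inv (suc m))))
  inv-* (suc m) (suc n) = sym (inv-unique (n ℕ.+ m ℕ.* suc n) (begin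
    ι (suc m ℕ.* suc n) * (inv (suc m) * inv (suc n))          ≡⟨ cong (_* (inv (suc m) * inv (suc n))) (ι-* (suc m) (suc n)) ⟩
    ι (suc m) * ι (suc n) * (inv (suc m) * inv (suc n))        ≡⟨ interchange (ι (suc m)) (ι (suc n)) (inv (suc m)) (inv (suc n)) ⟩
    (ι (suc m) * inv (suc m)) * (ι (suc n) * inv (suc n))      ≡⟨ cong₂ _*_ (ι*inv m) (ι*inv n) ⟩
    1ℚ                                                         ∎))
    where
    open ≡-Reasoning
    interchange : ∀ a b c d → a * b * (c * d) ≡ (a * c) * (b * d)
    interchange = solve-∀ ring

  inv-antimono : ∀ {m n} → suc m ℕ.≤ n → inv n ≤ inv (suc m)
  inv-antimono {m} {suc n} m≤n = *-cancel-≤ (*-pos (0<ι m) (0<ι n)) (begin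
    ι (suc m) * ι (suc n) * inv (suc n)    ≡⟨ *-assoc (ι (suc m)) (ι (suc n)) (inv (suc n)) ⟩
    ι (suc m) * (ι (suc n) * inv (suc n))  ≡⟨ cong (ι (suc m) *_) (ι*inv n) ⟩
    ι (suc m) * 1ℚ                         ≡⟨ *-identityʳ (ι (suc m)) ⟩
    ι (suc m)                              ≤⟨ ι-mono m≤n ⟩
    ι (suc n)                              ≡⟨ *-identityʳ (ι (suc n)) ⟨
    ι (suc n) * 1ℚ                         ≡⟨ cong (ι (suc n) *_) (ι*inv m) ⟨
    ι (suc n) * (ι (suc m) * inv (suc m))  ≡⟨ rearrange (ι (suc m)) (ι (suc n)) (inv (suc m)) ⟩
    ι (suc m) * ι (suc n) * inv (suc m)    ∎)
    where
    open ≤-Reasoning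
    rearrange : ∀ a b c → b * (a * c) ≡ a * b * c
    rearrange = solve-∀ ring

  archimedean : ∀ ε → 0ℚ < ε → ∃ λ n → inv (suc n) < ε
  archimedean (mkℚ (pos zero)  d _) (*<* (ℤ.+<+ ()))
  archimedean (mkℚ -[1+ n ]  d _) (*<* ())
  -- A positive ε with denominator d + 1 is at least 1/(d + 1), and 1/(d + 2) lies strictly below
  -- that.
  archimedean ε@(mkℚ +[1+ n ] d _) _ = suc d , toℚᵘ-cancel-< (ℚᵘₚ.<-respˡ-≃ (ℚᵘₚ.≃-sym (toℚᵘ-inv (suc d))) (ℚᵘ.*<*
    (ℤ.+<+ (ℕₚ.≤-trans (ℕ.s≤s (ℕₚ.≤-reflexive (cong suc (ℕₚ.+-identityʳ d)))) (ℕₚ.m≤m+n (suc (suc d)) (n ℕ.* suc (suc d)))))))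

  unbounded : ∀ x → ∃ λ n → x < ι n
  unbounded x@(mkℚ (pos n) d _) = suc n , toℚᵘ-cancel-< (ℚᵘₚ.<-respʳ-≃ (ℚᵘₚ.≃-sym (toℚᵘ-ι (suc n))) (ℚᵘ.*<*
    (subst (ℤ._< pos (suc n) ℤ.* pos (suc d)) (sym (ℤₚ.*-identityʳ (pos n))) (ℤ.+<+ (ℕ.s≤s (ℕₚ.≤-trans (ℕₚ.m≤m*n n (suc d)) (ℕₚ.m≤n+m _ d)))))))
  unbounded x@(mkℚ -[1+ n ] d _) = 0 , *<* ℤ.-<+

  multiple-exceeds : ∀ x ε → 0ℚ < ε → ∃ λ n → x < ι n * ε
  multiple-exceeds x ε 0<ε with unbounded x | archimedean ε 0<ε
  ... | a , x<a | b , b<ε = a ℕ.* suc b , (begin-strict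
    x                                <⟨ x<a ⟩
    ι a                              ≡⟨ *-identityʳ (ι a) ⟨
    ι a * 1ℚ                         ≡⟨ cong (ι a *_) (ι*inv b) ⟨
    ι a * (ι (suc b) * inv (suc b))  ≡⟨ *-assoc (ι a) (ι (suc b)) (inv (suc b)) ⟨
    ι a * ι (suc b) * inv (suc b)    ≤⟨ *-monoˡ (*-nonNeg (0≤ι a) (0≤ι (suc b))) (<⇒≤ b<ε) ⟩
    ι a * ι (suc b) * ε              ≡⟨ cong (_* ε) (ι-* a (suc b)) ⟨
    ι (a ℕ.* suc b) * ε              ∎)
    where open ≤-Reasoning

  -- Finite sums

  ∑ : ℕ → (ℕ → ℚ) → ℚ
  ∑ zero    f = 0ℚ
  ∑ (suc n) f = ∑ n f + f n

  Σ1≡∑ : ∀ n f → Σ1 n f ≡ ∑ n (f ∘ suc)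
  Σ1≡∑ zero    f = refl
  Σ1≡∑ (suc n) f = cong (_+ f (suc n)) (Σ1≡∑ n f)

  ∑-cong : ∀ n {f g} → (∀ j → f j ≡ g j) → ∑ n f ≡ ∑ n g
  ∑-cong zero    f≗g = refl
  ∑-cong (suc n) f≗g = cong₂ _+_ (∑-cong n f≗g) (f≗g n)

  ∑-mono : ∀ n {f g} → (∀ j → f j ≤ g j) → ∑ n f ≤ ∑ n g
  ∑-mono zero    f≤g = ≤-refl
  ∑-mono (suc n) f≤g = +-mono-≤ (∑-mono n f≤g) (f≤g n)

  ∑-nonNeg : ∀ n {f} → (∀ j → 0ℚ ≤ f j) → 0ℚ ≤ ∑ n f
  ∑-nonNeg zero    0≤f = ≤-refl
  ∑-nonNeg (suc n) 0≤f = +-nonNeg (∑-nonNeg n 0≤f) (0≤f n)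

  ∑-+ : ∀ n f g → ∑ n (λ j → f j + g j) ≡ ∑ n f + ∑ n g
  ∑-+ zero    f g = refl
  ∑-+ (suc n) f g = trans (cong (_+ (f n + g n)) (∑-+ n f g)) (interchange (∑ n f) (∑ n g) (f n) (g n))
    where
    interchange : ∀ a b c d → a + b + (c + d) ≡ a + c + (b + d)
    interchange = solve-∀ ring

  ∑-*ˡ : ∀ n c f → ∑ n (λ j → c * f j) ≡ c * ∑ n f
  ∑-*ˡ zero    c f = sym (*-zeroʳ c)
  ∑-*ˡ (suc n) c f = trans (cong (_+ c * f n) (∑-*ˡ n c f)) (sym (*-distribˡ-+ c (∑ n f) (f n)))

  ∑-sub : ∀ n f g → ∑ n (λ j → f j - g j) ≡ ∑ n f - ∑ n g
  ∑-sub zero    f g = refl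
  ∑-sub (suc n) f g = trans (cong (_+ (f n - g n)) (∑-sub n f g)) (interchange (∑ n f) (∑ n g) (f n) (g n))
    where
    interchange : ∀ a b c d → a - b + (c - d) ≡ a + c - (b + d)
    interchange = solve-∀ ring

  ∑-telescope : ∀ n (f : ℕ → ℚ) → ∑ n (λ j → f j - f (suc j)) ≡ f 0 - f n
  ∑-telescope zero    f = sym (+-inverseʳ (f 0))
  ∑-telescope (suc n) f = trans (cong (_+ (f n - f (suc n))) (∑-telescope n f)) (cancel (f 0) (f n) (f (suc n)))
    where
    cancel : ∀ a b c → a - b + (b - c) ≡ a - c
    cancel = solve-∀ ring

  ∑-swap : ∀ m n (f : ℕ → ℕ → ℚ) → ∑ m (λ i → ∑ n (f i)) ≡ ∑ n (λ j → ∑ m (λ i → f i j))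
  ∑-swap zero    n f = sym (trans (∑-cong n (λ j → sym (*-zeroˡ 0ℚ))) (trans (∑-*ˡ n 0ℚ (λ _ → 0ℚ)) (*-zeroˡ (∑ n (λ _ → 0ℚ)))))
  ∑-swap (suc m) n f = trans (cong (_+ ∑ n (f m)) (∑-swap m n f)) (sym (∑-+ n (λ j → ∑ m (λ i → f i j)) (f m)))

  ∑-split : ∀ m n f → ∑ (m ℕ.+ n) f ≡ ∑ m f + ∑ n (λ j → f (m ℕ.+ j))
  ∑-split m zero    f = trans (cong (λ k → ∑ k f) (ℕₚ.+-identityʳ m)) (sym (+-identityʳ (∑ m f)))
  ∑-split m (suc n) f = begin
    ∑ (m ℕ.+ suc n) f                                         ≡⟨ cong (λ k → ∑ k f) (ℕₚ.+-suc m n) ⟩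
    ∑ (m ℕ.+ n) f + f (m ℕ.+ n)                               ≡⟨ cong (_+ f (m ℕ.+ n)) (∑-split m n f) ⟩
    ∑ m f + ∑ n (λ j → f (m ℕ.+ j)) + f (m ℕ.+ n)             ≡⟨ +-assoc (∑ m f) (∑ n (λ j → f (m ℕ.+ j))) (f (m ℕ.+ n)) ⟩
    ∑ m f + (∑ n (λ j → f (m ℕ.+ j)) + f (m ℕ.+ n))           ∎
    where open ≡-Reasoning

  ∑-≥const : ∀ n {c f} → (∀ j → j ℕ.< n → c ≤ f j) → ι n * c ≤ ∑ n f
  ∑-≥const zero    {c}     c≤f = ≤-reflexive (*-zeroˡ c)
  ∑-≥const (suc n) {c} {f} c≤f = begin
    ι (suc n) * c    ≡⟨ cong (_* c) (ι-suc n) ⟩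
    (1ℚ + ι n) * c   ≡⟨ expand (ι n) c ⟩
    ι n * c + c      ≤⟨ +-mono-≤ (∑-≥const n (λ j j<n → c≤f j (ℕₚ.m<n⇒m<1+n j<n))) (c≤f n ℕₚ.≤-refl) ⟩
    ∑ n f + f n      ∎
    where
    open ≤-Reasoning
    expand : ∀ a b → (1ℚ + a) * b ≡ a * b + b
    expand = solve-∀ ring

  ∑-≤const : ∀ n {c f} → (∀ j → f j ≤ c) → ∑ n f ≤ ι n * c
  ∑-≤const zero    {c}     f≤c = ≤-reflexive (sym (*-zeroˡ c))
  ∑-≤const (suc n) {c} {f} f≤c = begin
    ∑ n f + f n      ≤⟨ +-mono-≤ (∑-≤const n f≤c) (f≤c n) ⟩
    ι n * c + c      ≡⟨ collect (ι n) c ⟩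
    (1ℚ + ι n) * c   ≡⟨ cong (_* c) (ι-suc n) ⟨
    ι (suc n) * c    ∎
    where
    open ≤-Reasoning
    collect : ∀ a b → a * b + b ≡ (1ℚ + a) * b
    collect = solve-∀ ring

  -- Null sequences

  Null : (ℕ → ℚ) → Set
  Null f = ∀ (ε : ℚ) → 0ℚ < ε → ∃ λ N → ∀ M → N ℕ.≤ M → ∣ f M ∣ < ε

  x≤∣x∣ : ∀ x → x ≤ ∣ x ∣
  x≤∣x∣ x with ≤-total 0ℚ x
  ... | inj₁ 0≤x = ≤-reflexive (sym (0≤p⇒∣p∣≡p 0≤x))
  ... | inj₂ x≤0 = ≤-trans x≤0 (0≤∣p∣ x)

  null-≤ : ∀ {f g} N₀ → (∀ n → N₀ ℕ.≤ n → ∣ f n ∣ ≤ g n) → Null g → Null f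
  null-≤ {g = g} N₀ f≤g g→0 ε 0<ε with g→0 ε 0<ε
  ... | N , bound = N₀ ℕ.+ N , λ M N≤M →
    ≤-<-trans (≤-trans (f≤g M (ℕₚ.≤-trans (ℕₚ.m≤m+n N₀ N) N≤M)) (x≤∣x∣ (g M)))
              (bound M (ℕₚ.≤-trans (ℕₚ.m≤n+m N N₀) N≤M))

  null-squeeze : ∀ {f g} N₀ → (∀ n → N₀ ℕ.≤ n → 0ℚ ≤ f n) → (∀ n → N₀ ℕ.≤ n → f n ≤ g n) → Null g → Null f
  null-squeeze {g = g} N₀ 0≤f f≤g = null-≤ N₀ λ n le → subst (_≤ g n) (sym (0≤p⇒∣p∣≡p (0≤f n le))) (f≤g n le)

  null-cong : ∀ {f g} → (∀ n → f n ≡ g n) → Null g → Null f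
  null-cong f≗g g→0 ε 0<ε with g→0 ε 0<ε
  ... | N , bound = N , λ M N≤M → subst (λ x → ∣ x ∣ < ε) (sym (f≗g M)) (bound M N≤M)

  null-zero : Null (λ _ → 0ℚ)
  null-zero ε 0<ε = 0 , λ _ _ → 0<ε

  null-+ : ∀ {f g} → Null f → Null g → Null (λ n → f n + g n)
  null-+ {f} {g} f→0 g→0 ε 0<ε with f→0 (½ * ε) (*-pos 0<½ 0<ε) | g→0 (½ * ε) (*-pos 0<½ 0<ε)
  ... | M , boundf | N , boundg = M ℕ.+ N , λ n le → begin-strict
    ∣ f n + g n ∣        ≤⟨ ∣p+q∣≤∣p∣+∣q∣ (f n) (g n) ⟩
    ∣ f n ∣ + ∣ g n ∣    <⟨ +-mono-< (boundf n (ℕₚ.≤-trans (ℕₚ.m≤m+n M N) le)) (boundg n (ℕₚ.≤-trans (ℕₚ.m≤n+m N M) le)) ⟩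
    ½ * ε + ½ * ε        ≡⟨ halves ε ⟩
    ε                    ∎
    where
    open ≤-Reasoning
    halves : ∀ x → ½ * x + ½ * x ≡ x
    halves = solve-∀ ring

  null-* : ∀ c {f} → Null f → Null (λ n → c * f n)
  null-* c {f} f→0 ε 0<ε with unbounded ∣ c ∣
  ... | zero  , c<0 with () ← <-irrefl refl (≤-<-trans (0≤∣p∣ c) c<0)
  ... | suc k , c<k with f→0 (inv (suc k) * ε) (*-pos (0<inv k) 0<ε)
  ...   | N , bound = N , λ n le → begin-strict
    ∣ c * f n ∣                    ≡⟨ ∣p*q∣≡∣p∣*∣q∣ c (f n) ⟩
    ∣ c ∣ * ∣ f n ∣                ≤⟨ *-monoʳ (0≤∣p∣ (f n)) (<⇒≤ c<k) ⟩
    ι (suc k) * ∣ f n ∣            <⟨ *-monoʳ-<-pos (ι (suc k)) {{positive (0<ι k)}} (bound n le) ⟩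
    ι (suc k) * (inv (suc k) * ε)  ≡⟨ *-assoc (ι (suc k)) (inv (suc k)) ε ⟨
    ι (suc k) * inv (suc k) * ε    ≡⟨ cong (_* ε) (ι*inv k) ⟩
    1ℚ * ε                         ≡⟨ *-identityˡ ε ⟩
    ε                              ∎
    where open ≤-Reasoning

  null-shift : ∀ {f} → Null f → Null (f ∘ suc)
  null-shift f→0 ε 0<ε with f→0 ε 0<ε
  ... | N , bound = N , λ M N≤M → bound (suc M) (ℕₚ.m≤n⇒m≤1+n N≤M)

  null-unshift : ∀ {f} → Null (f ∘ suc) → Null f
  null-unshift f→0 ε 0<ε with f→0 ε 0<ε
  ... | N , bound = suc N , λ where (suc M) (ℕ.s≤s N≤M) → bound M N≤M

  null-inv : Null (inv ∘ suc)
  null-inv ε 0<ε with archimedean ε 0<ε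
  ... | N , bound = N , λ M N≤M → subst (_< ε) (sym (0≤p⇒∣p∣≡p (0≤inv (suc M)))) (≤-<-trans (inv-antimono (ℕ.s≤s N≤M)) bound)

  -- Divergence of the harmonic series and a contraction argument

  half-harmonic : ℕ → ℚ
  half-harmonic n = 1ℚ + ∑ n (λ j → ½ * inv (suc j))

  1≤half-harmonic : ∀ n → 1ℚ ≤ half-harmonic n
  1≤half-harmonic n = ≤-by (∑ n (λ j → ½ * inv (suc j))) (∑-nonNeg n (λ j → *-nonNeg 0≤½ (0≤inv (suc j)))) refl

  0<half-harmonic : ∀ n → 0ℚ < half-harmonic n
  0<half-harmonic n = <-≤-trans (0<ι 0) (1≤half-harmonic n)

  half-harmonic-split : ∀ m n → half-harmonic (m ℕ.+ n) ≡ half-harmonic m + ∑ n (λ j → ½ * inv (suc (m ℕ.+ j)))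
  half-harmonic-split m n = trans (cong (1ℚ +_) (∑-split m n (λ j → ½ * inv (suc j))))
    (sym (+-assoc 1ℚ (∑ m (λ j → ½ * inv (suc j))) (∑ n (λ j → ½ * inv (suc (m ℕ.+ j))))))

  half-harmonic-mono : ∀ {m n} → m ℕ.≤ n → half-harmonic m ≤ half-harmonic n
  half-harmonic-mono {m} {n} m≤n = ≤-by (∑ (n ∸ m) (λ j → ½ * inv (suc (m ℕ.+ j))))
    (∑-nonNeg (n ∸ m) (λ j → *-nonNeg 0≤½ (0≤inv (suc (m ℕ.+ j)))))
    (trans (cong half-harmonic (sym (ℕₚ.m+[n∸m]≡n m≤n))) (half-harmonic-split m (n ∸ m)))

  -- Oresme's argument: the m new terms are each at least 1/2 · 1/(2m), so every doubling of the
  -- index adds at least 1/4.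
  half-harmonic-double : ∀ n → half-harmonic (suc n) + ½ * ½ ≤ half-harmonic (suc n ℕ.+ suc n)
  half-harmonic-double n = begin
    half-harmonic m + ½ * ½                                    ≡⟨ cong (half-harmonic m +_) quarter ⟩
    half-harmonic m + ι m * (½ * inv (m ℕ.+ m))                ≤⟨ +-monoʳ-≤ (half-harmonic m) (∑-≥const m λ j j<m →
                                                                    *-monoˡ 0≤½ (inv-antimono (ℕₚ.+-monoʳ-< m j<m))) ⟩
    half-harmonic m + ∑ m (λ j → ½ * inv (suc (m ℕ.+ j)))      ≡⟨ half-harmonic-split m m ⟨
    half-harmonic (m ℕ.+ m)                                    ∎
    where
    open ≤-Reasoning
    m = suc n
    halve : ∀ a b → a * (½ * b) ≡ ½ * (½ * ((a + a) * b))
    halve = solve-∀ ring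
    quarter : ½ * ½ ≡ ι m * (½ * inv (m ℕ.+ m))
    quarter = sym (trans (halve (ι m) (inv (m ℕ.+ m)))
      (cong (λ x → ½ * (½ * x)) (trans (cong (_* inv (m ℕ.+ m)) (sym (ι-+ m m))) (ι*inv (n ℕ.+ m)))))

  half-harmonic-diverges : ∀ p → ∃ λ n → ι p * (½ * ½) ≤ half-harmonic (suc n)
  half-harmonic-diverges zero    = 0 , ≤-trans (≤-reflexive (*-zeroˡ (½ * ½))) (<⇒≤ (0<half-harmonic 1))
  half-harmonic-diverges (suc p) with half-harmonic-diverges p
  -- The successor of this witness is by definition `suc n + suc n`, the doubled index.
  ... | n , bound = n ℕ.+ suc n , (begin
    ι (suc p) * (½ * ½)               ≡⟨ cong (_* (½ * ½)) (ι-suc p) ⟩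
    (1ℚ + ι p) * (½ * ½)              ≡⟨ expand (ι p) ⟩
    ι p * (½ * ½) + ½ * ½             ≤⟨ +-monoˡ-≤ (½ * ½) bound ⟩
    half-harmonic (suc n) + ½ * ½     ≤⟨ half-harmonic-double n ⟩
    half-harmonic (suc n ℕ.+ suc n)   ∎)
    where
    open ≤-Reasoning
    expand : ∀ a → (1ℚ + a) * (½ * ½) ≡ a * (½ * ½) + ½ * ½
    expand = solve-∀ ring

  module _ {β} {a e : ℕ → ℚ} (0≤β : 0ℚ ≤ β) (β≤1 : β ≤ 1ℚ) where

    private
      h : ℕ → ℚ
      h = half-harmonic

      0≤factor : ∀ n → 0ℚ ≤ ι n + β
      0≤factor n = +-nonNeg (0≤ι n) 0≤β

      0<factor+½ : ∀ n → 0ℚ < ι n + β + ½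
      0<factor+½ n = +-mono-≤-< (0≤factor n) 0<½

      factor≤ι : ∀ n → ι n + β ≤ ι (suc n)
      factor≤ι n = begin
        ι n + β     ≤⟨ +-monoʳ-≤ (ι n) β≤1 ⟩
        ι n + 1ℚ    ≡⟨ +-comm (ι n) 1ℚ ⟩
        1ℚ + ι n    ≡⟨ ι-suc n ⟨
        ι (suc n)   ∎
        where open ≤-Reasoning

      -- The weight `h` grows more slowly than the recurrence contracts. Its increment times n + β
      -- is at most 1/2, because n + β ≤ n + 1, and the initial summand 1 in `half-harmonic` makes
      -- 1/2 ≤ 1/2 · `h n`.
      half-harmonic-growth : ∀ n → h (suc n) * (ι n + β) ≤ (ι n + β + ½) * h n
      half-harmonic-growth n = begin
        (1ℚ + (s + ½ * inv (suc n))) * f         ≡⟨ expand s (inv (suc n)) f ⟩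
        f * (1ℚ + s) + ½ * (f * inv (suc n))     ≤⟨ +-monoʳ-≤ (f * (1ℚ + s)) (*-monoˡ 0≤½ (begin
          f * inv (suc n)                        ≤⟨ *-monoʳ (0≤inv (suc n)) (factor≤ι n) ⟩
          ι (suc n) * inv (suc n)                ≡⟨ ι*inv n ⟩
          1ℚ                                     ≤⟨ 1≤half-harmonic n ⟩
          h n                                    ∎)) ⟩
        f * (1ℚ + s) + ½ * (1ℚ + s)              ≡⟨ *-distribʳ-+ (1ℚ + s) f ½ ⟨
        (f + ½) * h n                            ∎
        where
        open ≤-Reasoning
        s f : ℚ
        s = ∑ n (λ j → ½ * inv (suc j))
        f = ι n + β
        expand : ∀ s i f → (1ℚ + (s + ½ * i)) * f ≡ f * (1ℚ + s) + ½ * (f * i)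
        expand = solve-∀ ring

    private
      module Contraction
        (rec : ∀ n → (ι n + β + ½) * a (suc n) ≤ (ι n + β) * a n + e n)
        (ε : ℚ) (0<ε : 0ℚ < ε)
        (N₀ : ℕ) (small : ∀ n → N₀ ℕ.≤ n → ∣ e n ∣ < ½ * ε) where

        open ≤-Reasoning

        excess : ℕ → ℚ
        excess n = a n - ε

        -- With the perturbation replaced by its bound ε/2, the constant sequence ε solves the
        -- recurrence exactly. Subtracting it leaves a homogeneous inequality.
        excess-step : ∀ n → N₀ ℕ.≤ n → (ι n + β + ½) * excess (suc n) ≤ (ι n + β) * excess n
        excess-step n N₀≤n = begin
          (f + ½) * (a (suc n) - ε)                 ≡⟨ expand f (a (suc n)) ε ⟩
          (f + ½) * a (suc n) - (f * ε + ½ * ε)     ≤⟨ +-monoˡ-≤ (- (f * ε + ½ * ε)) (≤-trans (rec n)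
                                                         (+-monoʳ-≤ (f * a n) (≤-trans (x≤∣x∣ (e n)) (<⇒≤ (small n N₀≤n))))) ⟩
          f * a n + ½ * ε - (f * ε + ½ * ε)         ≡⟨ collect f (a n) ε ⟩
          f * (a n - ε)                             ∎
          where
          f : ℚ
          f = ι n + β
          expand : ∀ f a x → (f + ½) * (a - x) ≡ (f + ½) * a - (f * x + ½ * x)
          expand = solve-∀ ring
          collect : ∀ f a x → f * a + ½ * x - (f * x + ½ * x) ≡ f * (a - x)
          collect = solve-∀ ring

        -- The absolute value makes the bound nonnegative, so a step from a nonpositive excess
        -- satisfies it trivially and only positive excesses need `half-harmonic-growth`.
        K : ℚ
        K = ∣ h N₀ * excess N₀ ∣

        weighted-step : ∀ n → N₀ ℕ.≤ n → h n * excess n ≤ K → h (suc n) * excess (suc n) ≤ K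
        weighted-step n N₀≤n bound = *-cancel-≤ (0<factor+½ n) (begin
          (f + ½) * (h (suc n) * excess (suc n))     ≡⟨ swap (f + ½) (h (suc n)) (excess (suc n)) ⟩
          h (suc n) * ((f + ½) * excess (suc n))     ≤⟨ *-monoˡ (<⇒≤ (0<half-harmonic (suc n))) (excess-step n N₀≤n) ⟩
          h (suc n) * (f * excess n)                 ≡⟨ *-assoc (h (suc n)) f (excess n) ⟨
          h (suc n) * f * excess n                   ≤⟨ by-sign (≤-total 0ℚ (excess n)) ⟩
          (f + ½) * K                                ∎)
          where
          f : ℚ
          f = ι n + β
          swap : ∀ x y z → x * (y * z) ≡ y * (x * z)
          swap = solve-∀ ring
          by-sign : 0ℚ ≤ excess n ⊎ excess n ≤ 0ℚ → h (suc n) * f * excess n ≤ (f + ½) * K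
          by-sign (inj₁ 0≤d) = begin
            h (suc n) * f * excess n      ≤⟨ *-monoʳ 0≤d (half-harmonic-growth n) ⟩
            (f + ½) * h n * excess n      ≡⟨ *-assoc (f + ½) (h n) (excess n) ⟩
            (f + ½) * (h n * excess n)    ≤⟨ *-monoˡ (<⇒≤ (0<factor+½ n)) bound ⟩
            (f + ½) * K                   ∎
          by-sign (inj₂ d≤0) = begin
            h (suc n) * f * excess n      ≤⟨ *-monoˡ (*-nonNeg (<⇒≤ (0<half-harmonic (suc n))) (0≤factor n)) d≤0 ⟩
            h (suc n) * f * 0ℚ            ≡⟨ *-zeroʳ (h (suc n) * f) ⟩
            0ℚ                            ≤⟨ *-nonNeg (<⇒≤ (0<factor+½ n)) (0≤∣p∣ (h N₀ * excess N₀)) ⟩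
            (f + ½) * K                   ∎

        weighted-bound : ∀ k → h (k ℕ.+ N₀) * excess (k ℕ.+ N₀) ≤ K
        weighted-bound zero    = x≤∣x∣ (h N₀ * excess N₀)
        weighted-bound (suc k) = weighted-step (k ℕ.+ N₀) (ℕₚ.m≤n+m N₀ k) (weighted-bound k)

        excess-small : ∀ M → N₀ ℕ.≤ M → K < h M * ε → excess M < ε
        excess-small M N₀≤M K<hε = *-cancelˡ-<-nonNeg (h M) {{nonNegative (<⇒≤ (0<half-harmonic M))}} (≤-<-trans
          (subst (λ m → h m * excess m ≤ K) (ℕₚ.m∸n+n≡m N₀≤M) (weighted-bound (M ∸ N₀))) K<hε)

        h-exceeds : ∃ λ N → ∀ M → N ℕ.≤ M → K < h M * ε
        h-exceeds =
          let q , K<q  = multiple-exceeds K (½ * ½ * ε) (*-pos (*-pos 0<½ 0<½) 0<ε)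
              n₁ , q≤h = half-harmonic-diverges q
          in suc n₁ , λ M le → begin-strict
            K                    <⟨ K<q ⟩
            ι q * (½ * ½ * ε)    ≡⟨ *-assoc (ι q) (½ * ½) ε ⟨
            ι q * (½ * ½) * ε    ≤⟨ *-monoʳ (<⇒≤ 0<ε) (≤-trans q≤h (half-harmonic-mono le)) ⟩
            h M * ε              ∎

        eventually-small : ∃ λ N → ∀ M → N ℕ.≤ M → a M < ε + ε
        eventually-small =
          let N , exceeds = h-exceeds
          in N ℕ.+ N₀ , λ M le → begin-strict
            a M              ≡⟨ uncancel (a M) ε ⟩
            excess M + ε     <⟨ +-monoˡ-< ε (excess-small M (ℕₚ.≤-trans (ℕₚ.m≤n+m N₀ N) le)
                                              (exceeds M (ℕₚ.≤-trans (ℕₚ.m≤m+n N N₀) le))) ⟩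
            ε + ε            ∎
          where
          uncancel : ∀ x y → x ≡ x - y + y
          uncancel = solve-∀ ring

    -- The recurrence contracts the excess of a over any fixed ε by 1 − O(1/n) once e is small, and Σ 1/n diverges.
    contraction-null : (∀ n → 0ℚ ≤ a n) →
                       (∀ n → (ι n + β + ½) * a (suc n) ≤ (ι n + β) * a n + e n) →
                       Null e → Null a
    contraction-null 0≤a rec e→0 ε 0<ε =
      let N₀ , small = e→0 (½ * (½ * ε)) (*-pos 0<½ (*-pos 0<½ 0<ε))
          N , bound  = Contraction.eventually-small rec (½ * ε) (*-pos 0<½ 0<ε) N₀ small
      in N , λ M le → subst₂ _<_ (sym (0≤p⇒∣p∣≡p (0≤a M))) (halves ε) (bound M le)
      where
      halves : ∀ x → ½ * x + ½ * x ≡ x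
      halves = solve-∀ ring

  -- Coefficient sequences: δ is the constant 1 and sh the multiplication by the variable.

  δ : ℕ → ℚ
  δ zero    = 1ℚ
  δ (suc _) = 0ℚ

  sh : (ℕ → ℚ) → ℕ → ℚ
  sh f zero    = 0ℚ
  sh f (suc u) = f u

  sh-+ : ∀ f g u → sh (λ u → f u + g u) u ≡ sh f u + sh g u
  sh-+ f g zero    = refl
  sh-+ f g (suc u) = refl

  sh-*ˡ : ∀ k f u → sh (λ u → k * f u) u ≡ k * sh f u
  sh-*ˡ k f zero    = sym (*-zeroʳ k)
  sh-*ˡ k f (suc u) = refl

  sh-*ʳ : ∀ k f u → sh (λ u → f u * k) u ≡ sh f u * k
  sh-*ʳ k f zero    = sym (*-zeroˡ k)
  sh-*ʳ k f (suc u) = refl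

  sh-zero : ∀ u → sh (λ _ → 0ℚ) u ≡ 0ℚ
  sh-zero zero    = refl
  sh-zero (suc u) = refl

  sh-nonNeg : ∀ {f} → (∀ u → 0ℚ ≤ f u) → ∀ u → 0ℚ ≤ sh f u
  sh-nonNeg 0≤f zero    = ≤-refl
  sh-nonNeg 0≤f (suc u) = 0≤f u

  sh-∑ : ∀ n (f : ℕ → ℕ → ℚ) u → sh (λ u → ∑ n (λ j → f j u)) u ≡ ∑ n (λ j → sh (f j) u)
  sh-∑ zero    f u = sh-zero u
  sh-∑ (suc n) f u = trans (sh-+ (λ u → ∑ n (λ j → f j u)) (f n) u) (cong (_+ sh (f n) u) (sh-∑ n f u))

  -- Powers of 1/(i + 1/2) and the odd part of the zeta series

  pow : ℚ → ℕ → ℚ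
  pow x zero    = 1ℚ
  pow x (suc n) = x * pow x n

  pow-nonNeg : ∀ {x} → 0ℚ ≤ x → ∀ n → 0ℚ ≤ pow x n
  pow-nonNeg 0≤x zero    = 0≤1
  pow-nonNeg 0≤x (suc n) = *-nonNeg 0≤x (pow-nonNeg 0≤x n)

  pow-mono : ∀ {x y} → 0ℚ ≤ x → x ≤ y → ∀ n → pow x n ≤ pow y n
  pow-mono 0≤x x≤y zero    = ≤-refl
  pow-mono 0≤x x≤y (suc n) = ≤-trans (*-monoʳ (pow-nonNeg 0≤x n) x≤y) (*-monoˡ (≤-trans 0≤x x≤y) (pow-mono 0≤x x≤y n))

  -- The reciprocal of i + 1/2, written with the odd denominator 2i + 1.
  ρ : ℕ → ℚ
  ρ i = ι 2 * inv (suc (2 ℕ.* i))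

  ρ-inverse : ∀ i → (½ + ι i) * ρ i ≡ 1ℚ
  ρ-inverse i = begin
    (½ + ι i) * (ι 2 * inv (suc (2 ℕ.* i)))       ≡⟨ rearrange (ι i) (inv (suc (2 ℕ.* i))) ⟩
    (1ℚ + ι 2 * ι i) * inv (suc (2 ℕ.* i))        ≡⟨ cong (λ x → (1ℚ + x) * inv (suc (2 ℕ.* i))) (ι-* 2 i) ⟨
    (1ℚ + ι (2 ℕ.* i)) * inv (suc (2 ℕ.* i))      ≡⟨ cong (_* inv (suc (2 ℕ.* i))) (ι-suc (2 ℕ.* i)) ⟨
    ι (suc (2 ℕ.* i)) * inv (suc (2 ℕ.* i))       ≡⟨ ι*inv (2 ℕ.* i) ⟩
    1ℚ                                            ∎
    where
    open ≡-Reasoning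
    rearrange : ∀ a b → (½ + a) * (ι 2 * b) ≡ (1ℚ + ι 2 * a) * b
    rearrange = solve-∀ ring

  0≤ρ : ∀ i → 0ℚ ≤ ρ i
  0≤ρ i = *-nonNeg (0≤ι 2) (0≤inv (suc (2 ℕ.* i)))

  ρ≤ : ∀ i → ρ i ≤ ι 2 * inv (suc i)
  ρ≤ i = *-monoˡ (0≤ι 2) (inv-antimono (ℕ.s≤s (ℕₚ.m≤n*m i 2)))

  ρ≤2 : ∀ i → ρ i ≤ ι 2
  ρ≤2 i = ≤-trans (ρ≤ i) (≤-trans (*-monoˡ (0≤ι 2) (inv-antimono {0} {suc i} (ℕ.s≤s ℕ.z≤n))) (≤-reflexive (*-identityʳ (ι 2))))

  null-ρ : Null ρ
  null-ρ = null-squeeze 0 (λ i _ → 0≤ρ i) (λ i _ → ρ≤ i) (null-* (ι 2) {inv ∘ suc} null-inv)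

  ∑-pairs : ∀ n f → ∑ (2 ℕ.* n) f ≡ ∑ n (λ i → f (2 ℕ.* i)) + ∑ n (λ i → f (suc (2 ℕ.* i)))
  ∑-pairs zero    f = refl
  ∑-pairs (suc n) f = begin
    ∑ (2 ℕ.* suc n) f                                     ≡⟨ cong (λ k → ∑ k f) (ℕₚ.*-suc 2 n) ⟩
    ∑ (2 ℕ.* n) f + f (2 ℕ.* n) + f (suc (2 ℕ.* n))       ≡⟨ cong (λ x → x + f (2 ℕ.* n) + f (suc (2 ℕ.* n))) (∑-pairs n f) ⟩
    e + o + f (2 ℕ.* n) + f (suc (2 ℕ.* n))               ≡⟨ interchange e o (f (2 ℕ.* n)) (f (suc (2 ℕ.* n))) ⟩
    e + f (2 ℕ.* n) + (o + f (suc (2 ℕ.* n)))             ∎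
    where
    open ≡-Reasoning
    e o : ℚ
    e = ∑ n (λ i → f (2 ℕ.* i))
    o = ∑ n (λ i → f (suc (2 ℕ.* i)))
    interchange : ∀ a b c d → a + b + c + d ≡ a + c + (b + d)
    interchange = solve-∀ ring

  ^-distrib-* : ∀ m n s → (m ℕ.* n) ^ s ≡ m ^ s ℕ.* n ^ s
  ^-distrib-* m n zero    = refl
  ^-distrib-* m n (suc s) = trans (cong (m ℕ.* n ℕ.*_) (^-distrib-* m n s)) (ℕₚ.[m*n]*[o*p]≡[m*o]*[n*p] m n (m ^ s) (n ^ s))

  pow-ι-inv : ∀ k m s → pow (ι k * inv m) s ≡ ι (k ^ s) * inv (m ^ s)
  pow-ι-inv k m zero    = refl
  pow-ι-inv k m (suc s) = begin
    ι k * inv m * pow (ι k * inv m) s               ≡⟨ cong (ι k * inv m *_) (pow-ι-inv k m s) ⟩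
    ι k * inv m * (ι (k ^ s) * inv (m ^ s))         ≡⟨ interchange (ι k) (inv m) (ι (k ^ s)) (inv (m ^ s)) ⟩
    ι k * ι (k ^ s) * (inv m * inv (m ^ s))         ≡⟨ cong₂ _*_ (ι-* k (k ^ s)) (inv-* m (m ^ s)) ⟨
    ι (k ℕ.* k ^ s) * inv (m ℕ.* m ^ s)             ∎
    where
    open ≡-Reasoning
    interchange : ∀ a b c d → a * b * (c * d) ≡ a * c * (b * d)
    interchange = solve-∀ ring

  pow-½ : ∀ k → pow ½ k ≡ inv (2 ^ k)
  pow-½ zero    = refl
  pow-½ (suc k) = trans (cong (½ *_) (pow-½ k)) (sym (inv-* 2 (2 ^ k)))

  pow-1 : ∀ k → pow 1ℚ k ≡ 1ℚ
  pow-1 zero    = refl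
  pow-1 (suc k) = trans (*-identityˡ (pow 1ℚ k)) (pow-1 k)

  ι*inv-pos : ∀ n → 1 ℕ.≤ n → ι n * inv n ≡ 1ℚ
  ι*inv-pos (suc n) _ = ι*inv n

  module _ (s : ℕ) (2≤s : 2 ℕ.≤ s) where

    private
      z : ℕ → ℚ
      z j = inv (suc j ^ s)

      2^s : ℚ
      2^s = ι (2 ^ s)

      z-even : ∀ i → z (suc (2 ℕ.* i)) ≡ inv (2 ^ s) * z i
      z-even i = begin
        inv (suc (suc (2 ℕ.* i)) ^ s)     ≡⟨ cong (λ k → inv (k ^ s)) (ℕₚ.*-suc 2 i) ⟨
        inv ((2 ℕ.* suc i) ^ s)           ≡⟨ cong inv (^-distrib-* 2 (suc i) s) ⟩
        inv (2 ^ s ℕ.* suc i ^ s)         ≡⟨ inv-* (2 ^ s) (suc i ^ s) ⟩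
        inv (2 ^ s) * z i                 ∎
        where open ≡-Reasoning

      z-tail : ℕ → ℚ
      z-tail N = ∑ N (λ j → z (N ℕ.+ j))

      -- The first 2N terms of the zeta series split into N odd terms, which are the powers of `ρ`
      -- divided by 2^s, and N even terms, which are 2^(-s) times the first N terms. The error is
      -- therefore governed by the block of terms from N + 1 to 2N.
      ∑-odd : ∀ N → ∑ N (λ i → pow (ρ i) s) - ι (2 ^ s ∸ 1) * ζpartial s N ≡ 2^s * z-tail N
      ∑-odd N = begin
        ∑ N (λ i → pow (ρ i) s) - ι (2 ^ s ∸ 1) * ζpartial s N
          ≡⟨ cong₂ (λ x y → x - ι (2 ^ s ∸ 1) * y)
               (trans (∑-cong N (λ i → pow-ι-inv 2 (suc (2 ℕ.* i)) s)) (∑-*ˡ N 2^s (λ i → z (2 ℕ.* i))))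
               (Σ1≡∑ N (λ n → inv (n ^ s))) ⟩
        2^s * o - ι (2 ^ s ∸ 1) * ∑ N z
          ≡⟨ regroup 2^s o (inv (2 ^ s)) (∑ N z) (ι (2 ^ s ∸ 1)) ⟩
        2^s * (o + inv (2 ^ s) * ∑ N z) - (2^s * inv (2 ^ s) + ι (2 ^ s ∸ 1)) * ∑ N z
          ≡⟨ cong₂ (λ x y → 2^s * x - y * ∑ N z) doubled one ⟩
        2^s * (∑ N z + z-tail N) - 2^s * ∑ N z
          ≡⟨ cancel 2^s (∑ N z) (z-tail N) ⟩
        2^s * z-tail N ∎
        where
        open ≡-Reasoning
        o : ℚ
        o = ∑ N (λ i → z (2 ℕ.* i))
        1≤2^s : 1 ℕ.≤ 2 ^ s
        1≤2^s = ℕₚ.m^n>0 2 s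
        one : 2^s * inv (2 ^ s) + ι (2 ^ s ∸ 1) ≡ 2^s
        one = trans (cong (_+ ι (2 ^ s ∸ 1)) (ι*inv-pos (2 ^ s) 1≤2^s))
          (trans (sym (ι-suc (2 ^ s ∸ 1))) (cong ι (ℕₚ.m+[n∸m]≡n 1≤2^s)))
        doubled : o + inv (2 ^ s) * ∑ N z ≡ ∑ N z + z-tail N
        doubled = begin
          o + inv (2 ^ s) * ∑ N z                        ≡⟨ cong (o +_) (∑-*ˡ N (inv (2 ^ s)) z) ⟨
          o + ∑ N (λ i → inv (2 ^ s) * z i)              ≡⟨ cong (o +_) (∑-cong N z-even) ⟨
          o + ∑ N (λ i → z (suc (2 ℕ.* i)))              ≡⟨ ∑-pairs N z ⟨
          ∑ (2 ℕ.* N) z                                  ≡⟨ cong (λ k → ∑ (N ℕ.+ k) z) (ℕₚ.+-identityʳ N) ⟩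
          ∑ (N ℕ.+ N) z                                  ≡⟨ ∑-split N N z ⟩
          ∑ N z + z-tail N                               ∎
        regroup : ∀ x o i z y → x * o - y * z ≡ x * (o + i * z) - (x * i + y) * z
        regroup = solve-∀ ring
        cancel : ∀ x z t → x * (z + t) - x * z ≡ x * t
        cancel = solve-∀ ring

      -- There are N terms, and s ≥ 2 bounds each of them by 1/(N + 1)².
      z-tail≤ : ∀ N → z-tail N ≤ inv (suc N)
      z-tail≤ N = begin
        z-tail N                                       ≤⟨ ∑-≤const N z≤ ⟩
        ι N * inv (M ℕ.* M)                            ≤⟨ *-monoʳ (0≤inv (M ℕ.* M)) (ι-mono (ℕₚ.n≤1+n N)) ⟩
        ι M * inv (M ℕ.* M)                            ≡⟨ cong (ι M *_) (inv-* M M) ⟩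
        ι M * (inv M * inv M)                          ≡⟨ *-assoc (ι M) (inv M) (inv M) ⟨
        ι M * inv M * inv M                            ≡⟨ cong (_* inv M) (ι*inv N) ⟩
        1ℚ * inv M                                     ≡⟨ *-identityˡ (inv M) ⟩
        inv M                                          ∎
        where
        open ≤-Reasoning
        M : ℕ
        M = suc N
        z≤ : ∀ j → z (N ℕ.+ j) ≤ inv (M ℕ.* M)
        z≤ j = inv-antimono (ℕₚ.≤-trans (ℕₚ.≤-reflexive (cong (M ℕ.*_) (sym (ℕₚ.*-identityʳ M))))
          (ℕₚ.≤-trans (ℕₚ.^-monoʳ-≤ M 2≤s) (ℕₚ.^-monoˡ-≤ s (ℕₚ.m≤m+n M j))))

    odd-zeta-null : Null (λ N → ∑ N (λ i → pow (ρ i) s) - ι (2 ^ s ∸ 1) * ζpartial s N)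
    odd-zeta-null = null-cong ∑-odd (null-* 2^s (null-squeeze 0
      (λ N _ → ∑-nonNeg N (λ j → 0≤inv (suc (N ℕ.+ j) ^ s))) (λ N _ → z-tail≤ N) null-inv))

  SeriesEqζ-odd : ∀ f k s → 2 ℕ.≤ s → Null (λ N → ∑ N (f ∘ suc) - k * ∑ N (λ i → pow (ρ i) s)) →
    SeriesEqζ f (k * ι (2 ^ s ∸ 1)) s
  SeriesEqζ-odd f k s 2≤s f-null = null-cong split (null-+ f-null (null-* k (odd-zeta-null s 2≤s)))
    where
    regroup : ∀ f k o t z → f - k * t * z ≡ f - k * o + k * (o - t * z)
    regroup = solve-∀ ring
    split : ∀ N → Σ1 N f - k * ι (2 ^ s ∸ 1) * ζpartial s N
      ≡ ∑ N (f ∘ suc) - k * ∑ N (λ i → pow (ρ i) s) + k * (∑ N (λ i → pow (ρ i) s) - ι (2 ^ s ∸ 1) * ζpartial s N)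
    split N = trans (cong (_- k * ι (2 ^ s ∸ 1) * ζpartial s N) (Σ1≡∑ N f))
      (regroup (∑ N (f ∘ suc)) k (∑ N (λ i → pow (ρ i) s)) (ι (2 ^ s ∸ 1)) (ζpartial s N))

  -- Partial sums start at n = 1, so agreement at successors suffices. At n = 0 the summands hold
  -- default values such as `inv 0` and `0 ∸ 1`.
  SeriesEqζ-cong : ∀ {f f′ k k′ s s′} → (∀ n → f (suc n) ≡ f′ (suc n)) → k ≡ k′ → s ≡ s′ →
    SeriesEqζ f′ k′ s′ → SeriesEqζ f k s
  SeriesEqζ-cong {f} {f′} {k} {s = s} f≗f′ refl refl = null-cong λ N → cong (_- k * ζpartial s N)
    (trans (Σ1≡∑ N f) (trans (∑-cong N f≗f′) (sym (Σ1≡∑ N f′))))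

  -- Binomial coefficients and factorials

  nC0≡1 : ∀ n → n C 0 ≡ 1
  nC0≡1 n = trans (nCk≡nC[n∸k] {0} {n} ℕ.z≤n) (nCn≡1 n)

  [m+n]Cm≡[m+n]Cn : ∀ m n → (m ℕ.+ n) C m ≡ (m ℕ.+ n) C n
  [m+n]Cm≡[m+n]Cn m n = trans (nCk≡nC[n∸k] (ℕₚ.m≤m+n m n)) (cong ((m ℕ.+ n) C_) (ℕₚ.m+n∸m≡n m n))

  2nCn*n!*n!≡[2n]! : ∀ n → ((2 ℕ.* n) C n) ℕ.* (n ! ℕ.* n !) ≡ (2 ℕ.* n) !
  2nCn*n!*n!≡[2n]! n = begin
    ((2 ℕ.* n) C n) ℕ.* (n ! ℕ.* n !)                      ≡⟨ cong (λ k → ((2 ℕ.* n) C n) ℕ.* (n ! ℕ.* k !)) 2n∸n≡n ⟨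
    ((2 ℕ.* n) C n) ℕ.* (n ! ℕ.* (2 ℕ.* n ∸ n) !)          ≡⟨ cong (ℕ._* (n ! ℕ.* (2 ℕ.* n ∸ n) !)) (nCk≡n!/k![n-k]! n≤2n) ⟩
    ((2 ℕ.* n) ! ℕ./ (n ! ℕ.* (2 ℕ.* n ∸ n) !)) ℕ.* (n ! ℕ.* (2 ℕ.* n ∸ n) !)
                                                            ≡⟨ m/n*n≡m (k![n∸k]!∣n! n≤2n) ⟩
    (2 ℕ.* n) !                                            ∎
    where
    open ≡-Reasoning
    instance _ = n ℕₚ.!* (2 ℕ.* n ∸ n) !≢0
    n≤2n : n ℕ.≤ 2 ℕ.* n
    n≤2n = ℕₚ.m≤n*m n 2
    2n∸n≡n : 2 ℕ.* n ∸ n ≡ n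
    2n∸n≡n = trans (ℕₚ.m+n∸m≡n n (n ℕ.+ 0)) (ℕₚ.+-identityʳ n)

  1≤n! : ∀ n → 1 ℕ.≤ n !
  1≤n! n = ℕₚ.n≢0⇒n>0 (ℕ.≢-nonZero⁻¹ (n !) {{n ℕₚ.!≢0}})

  0<ι-pos : ∀ n → 1 ℕ.≤ n → 0ℚ < ι n
  0<ι-pos (suc n) _ = 0<ι n

  1≤2nCn : ∀ n → 1 ℕ.≤ (2 ℕ.* n) C n
  1≤2nCn n = ℕₚ.n≢0⇒n>0 λ C≡0 → ℕₚ.<⇒≢ (1≤n! (2 ℕ.* n))
    (sym (trans (sym (2nCn*n!*n!≡[2n]! n)) (cong (ℕ._* (n ! ℕ.* n !)) C≡0)))

  2*suc∸1 : ∀ n → 2 ℕ.* suc n ∸ 1 ≡ suc (2 ℕ.* n)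
  2*suc∸1 n = ℕₚ.+-suc n (n ℕ.+ 0)

  ι-! : ∀ n → ι (suc n !) ≡ (1ℚ + ι n) * ι (n !)
  ι-! n = trans (ι-* (suc n) (n !)) (cong (_* ι (n !)) (ι-suc n))

  ι-4^ : ∀ n → ι (4 ^ suc n) ≡ ι 4 * ι (4 ^ n)
  ι-4^ n = ι-* 4 (4 ^ n)

  ι-[2n]! : ∀ n → ι ((2 ℕ.* suc n) !) ≡ (1ℚ + (1ℚ + ι 2 * ι n)) * ((1ℚ + ι 2 * ι n) * ι ((2 ℕ.* n) !))
  ι-[2n]! n = begin
    ι ((2 ℕ.* suc n) !)                                                       ≡⟨ cong (λ k → ι (k !)) (ℕₚ.*-suc 2 n) ⟩
    ι (suc (suc (2 ℕ.* n)) !)                                                 ≡⟨ ι-! (suc (2 ℕ.* n)) ⟩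
    (1ℚ + ι (suc (2 ℕ.* n))) * ι (suc (2 ℕ.* n) !)                            ≡⟨ cong₂ (λ x y → (1ℚ + x) * y) (ι-suc (2 ℕ.* n)) (ι-! (2 ℕ.* n)) ⟩
    (1ℚ + (1ℚ + ι (2 ℕ.* n))) * ((1ℚ + ι (2 ℕ.* n)) * ι ((2 ℕ.* n) !))        ≡⟨ cong (λ x → (1ℚ + (1ℚ + x)) * ((1ℚ + x) * ι ((2 ℕ.* n) !))) (ι-* 2 n) ⟩
    (1ℚ + (1ℚ + ι 2 * ι n)) * ((1ℚ + ι 2 * ι n) * ι ((2 ℕ.* n) !))            ∎
    where open ≡-Reasoning

  -- Formal counterpart of b = β + a X and g = β + ½ − c Y, with X, Y marking the two indices u, v.
  module WZ (β a c : ℚ) (0≤β : 0ℚ ≤ β) (β≤½ : β ≤ ½) (0≤a : 0ℚ ≤ a) (0≤c : 0ℚ ≤ c)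
    (r : ℕ → ℚ) (r-inverse : ∀ j → (β + ½ + ι j) * r j ≡ 1ℚ) where

    g : ℕ → ℚ
    g j = β + ½ + ι j

    0<g : ∀ j → 0ℚ < g j
    0<g j = +-mono-<-≤ (+-mono-≤-< 0≤β 0<½) (0≤ι j)

    g-+ : ∀ i n → g (i ℕ.+ n) ≡ g i + ι n
    g-+ i n = trans (cong (β + ½ +_) (ι-+ i n)) (sym (+-assoc (β + ½) (ι i) (ι n)))

    0≤r : ∀ j → 0ℚ ≤ r j
    0≤r j = *-cancel-≤ (0<g j) (subst₂ _≤_ (sym (*-zeroʳ (g j))) (sym (r-inverse j)) 0≤1)

    -- p n u is the coefficient of X^u in (b)_n.
    p : ℕ → ℕ → ℚ
    p zero    u       = δ u
    p (suc n) zero    = (ι n + β) * p n zero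
    p (suc n) (suc u) = (ι n + β) * p n (suc u) + a * p n u

    -- q n i v is the coefficient of Y^v in 1 / (g + i)_n.
    q : ℕ → ℕ → ℕ → ℚ
    q zero    i v       = δ v
    q (suc n) i zero    = r (i ℕ.+ n) * q n i zero
    q (suc n) i (suc v) = r (i ℕ.+ n) * (q n i (suc v) + c * q (suc n) i v)

    p-suc : ∀ n u → p (suc n) u ≡ (ι n + β) * p n u + a * sh (p n) u
    p-suc n zero    = sym (trans (cong ((ι n + β) * p n zero +_) (*-zeroʳ a)) (+-identityʳ ((ι n + β) * p n zero)))
    p-suc n (suc u) = refl

    g*r : ∀ j x → g j * (r j * x) ≡ x
    g*r j x = trans (sym (*-assoc (g j) (r j) x)) (trans (cong (_* x) (r-inverse j)) (*-identityˡ x))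

    q-suc : ∀ n i v → g (i ℕ.+ n) * q (suc n) i v ≡ q n i v + c * sh (q (suc n) i) v
    q-suc n i zero    = trans (g*r (i ℕ.+ n) (q n i zero))
      (sym (trans (cong (q n i zero +_) (*-zeroʳ c)) (+-identityʳ (q n i zero))))
    q-suc n i (suc v) = g*r (i ℕ.+ n) (q n i (suc v) + c * q (suc n) i v)

    0≤p : ∀ n u → 0ℚ ≤ p n u
    0≤p zero    zero    = 0≤1
    0≤p zero    (suc u) = ≤-refl
    0≤p (suc n) zero    = *-nonNeg (+-nonNeg (0≤ι n) 0≤β) (0≤p n zero)
    0≤p (suc n) (suc u) = +-nonNeg (*-nonNeg (+-nonNeg (0≤ι n) 0≤β) (0≤p n (suc u))) (*-nonNeg 0≤a (0≤p n u))

    0≤q : ∀ n i v → 0ℚ ≤ q n i v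
    0≤q zero    i zero    = 0≤1
    0≤q zero    i (suc v) = ≤-refl
    0≤q (suc n) i zero    = *-nonNeg (0≤r (i ℕ.+ n)) (0≤q n i zero)
    0≤q (suc n) i (suc v) = *-nonNeg (0≤r (i ℕ.+ n)) (+-nonNeg (0≤q n i (suc v)) (*-nonNeg 0≤c (0≤q (suc n) i v)))

    private
      -- Formally this cancels the common last factor G - cY: the second and first equations say (G
      -- - cY)R = S and (G - cY)Q₁ = Q₀, and Q₀ = (γ - cY)S is to give Q₁ = (γ - cY)R. On
      -- coefficients only the constant G > 0 can be cancelled, so the last hypothesis supplies the
      -- claim for the preceding power of Y.
      q-left-step : ∀ G γ Q₀ Q₁ Q₁′ R R′ R″ S S′ → 0ℚ < G →
        G * Q₁ ≡ Q₀ + c * Q₁′ → G * R ≡ S + c * R′ → G * R′ ≡ S′ + c * R″ →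
        Q₀ + c * S′ ≡ γ * S → Q₁′ + c * R″ ≡ γ * R′ → Q₁ + c * R′ ≡ γ * R
      q-left-step G γ Q₀ Q₁ Q₁′ R R′ R″ S S′ 0<G e₁ e₂ e₃ e₄ e₅ = *-cancel-≡ 0<G (begin
        G * (Q₁ + c * R′)                         ≡⟨ expand G Q₁ R′ c ⟩
        G * Q₁ + c * (G * R′)                     ≡⟨ cong₂ (λ x y → x + c * y) e₁ e₃ ⟩
        Q₀ + c * Q₁′ + c * (S′ + c * R″)          ≡⟨ regroup Q₀ Q₁′ S′ R″ c ⟩
        Q₀ + c * S′ + c * (Q₁′ + c * R″)          ≡⟨ cong₂ (λ x y → x + c * y) e₄ e₅ ⟩
        γ * S + c * (γ * R′)                      ≡⟨ factor γ S R′ c ⟩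
        γ * (S + c * R′)                          ≡⟨ cong (γ *_) e₂ ⟨
        γ * (G * R)                               ≡⟨ swap γ G R ⟩
        G * (γ * R)                               ∎)
        where
        open ≡-Reasoning
        expand : ∀ G Q R c → G * (Q + c * R) ≡ G * Q + c * (G * R)
        expand = solve-∀ ring
        regroup : ∀ Q₀ Q₁ S R c → Q₀ + c * Q₁ + c * (S + c * R) ≡ Q₀ + c * S + c * (Q₁ + c * R)
        regroup = solve-∀ ring
        factor : ∀ γ S R c → γ * S + c * (γ * R) ≡ γ * (S + c * R)
        factor = solve-∀ ring
        swap : ∀ x y z → x * (y * z) ≡ y * (x * z)
        swap = solve-∀ ring

      sh-q-suc : ∀ n i v → g (i ℕ.+ n) * sh (q (suc n) i) v ≡ sh (q n i) v + c * sh (sh (q (suc n) i)) v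
      sh-q-suc n i zero    = trans (*-zeroʳ (g (i ℕ.+ n))) (sym (trans (+-identityˡ (c * 0ℚ)) (*-zeroʳ c)))
      sh-q-suc n i (suc v) = q-suc n i v

    -- q-suc peels the last factor off (g + i)_{n+1}, and this the first one.
    q-left    : ∀ n i v → q n (suc i) v + c * sh (q (suc n) i) v ≡ g i * q (suc n) i v
    sh-q-left : ∀ n i v → sh (q n (suc i)) v + c * sh (sh (q (suc n) i)) v ≡ g i * sh (q (suc n) i) v

    q-left zero    i v = trans (sym (q-suc 0 i v)) (cong (λ j → g j * q 1 i v) (ℕₚ.+-identityʳ i))
    q-left (suc n) i v = q-left-step (g (suc i ℕ.+ n)) (g i)
      (q n (suc i) v) (q (suc n) (suc i) v) (sh (q (suc n) (suc i)) v)
      (q (suc (suc n)) i v) (sh (q (suc (suc n)) i) v) (sh (sh (q (suc (suc n)) i)) v)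
      (q (suc n) i v) (sh (q (suc n) i) v)
      (0<g (suc i ℕ.+ n)) (q-suc n (suc i) v)
      (subst (λ j → g j * q (suc (suc n)) i v ≡ q (suc n) i v + c * sh (q (suc (suc n)) i) v) (ℕₚ.+-suc i n) (q-suc (suc n) i v))
      (subst (λ j → g j * sh (q (suc (suc n)) i) v ≡ sh (q (suc n) i) v + c * sh (sh (q (suc (suc n)) i)) v) (ℕₚ.+-suc i n) (sh-q-suc (suc n) i v))
      (q-left n i v) (sh-q-left (suc n) i v)

    sh-q-left n i zero    = trans (trans (+-identityˡ (c * 0ℚ)) (*-zeroʳ c)) (sym (*-zeroʳ (g i)))
    sh-q-left n i (suc v) = q-left n i v

    -- Multiplying 1 / (g + i)_{n+1} by its last factor gives the first term, by its first factor
    -- the second. The two factors differ by n, and their Y-parts cancel.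
    q-difference : ∀ n i v → q n i v - q n (suc i) v ≡ ι n * q (suc n) i v
    q-difference n i v = begin
      q n i v - q n (suc i) v                                     ≡⟨ insert (q n i v) (q n (suc i) v) (c * sh (q (suc n) i) v) ⟩
      (q n i v + c * sh (q (suc n) i) v) - (q n (suc i) v + c * sh (q (suc n) i) v)
        ≡⟨ cong₂ _-_ (sym (trans (cong (_* q (suc n) i v) (sym (g-+ i n))) (q-suc n i v))) (q-left n i v) ⟩
      (g i + ι n) * q (suc n) i v - g i * q (suc n) i v           ≡⟨ cancel (g i) (ι n) (q (suc n) i v) ⟩
      ι n * q (suc n) i v                                         ∎
      where
      open ≡-Reasoning
      insert : ∀ x y z → x - y ≡ (x + z) - (y + z)
      insert = solve-∀ ring
      cancel : ∀ x y z → (x + y) * z - x * z ≡ y * z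
      cancel = solve-∀ ring

    -- Used in two ways: `V≤` drops the nonnegative remainder to bound the sum, while `F-telescope`
    -- keeps it as the boundary term.
    q-telescope : ∀ n J v → q n 0 v ≡ q n J v + ι n * ∑ J (λ i → q (suc n) i v)
    q-telescope n J v = begin
      q n 0 v                                              ≡⟨ uncancel (q n 0 v) (q n J v) ⟩
      q n J v + (q n 0 v - q n J v)                        ≡⟨ cong (q n J v +_) (∑-telescope J (λ i → q n i v)) ⟨
      q n J v + ∑ J (λ i → q n i v - q n (suc i) v)        ≡⟨ cong (q n J v +_) (∑-cong J (λ i → q-difference n i v)) ⟩
      q n J v + ∑ J (λ i → ι n * q (suc n) i v)            ≡⟨ cong (q n J v +_) (∑-*ˡ J (ι n) (λ i → q (suc n) i v)) ⟩
      q n J v + ι n * ∑ J (λ i → q (suc n) i v)            ∎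
      where
      open ≡-Reasoning
      uncancel : ∀ x y → x ≡ y + (x - y)
      uncancel = solve-∀ ring

    -- w i u v is the coefficient of X^u Y^v in 1 / (g + i − b), and W that in 1 / (1 − a X − c Y).
    W : ℕ → ℕ → ℚ
    W zero    zero    = 1ℚ
    W zero    (suc v) = c * W zero v
    W (suc u) zero    = a * W u zero
    W (suc u) (suc v) = a * W u (suc v) + c * W (suc u) v

    0≤W : ∀ u v → 0ℚ ≤ W u v
    0≤W zero    zero    = 0≤1
    0≤W zero    (suc v) = *-nonNeg 0≤c (0≤W zero v)
    0≤W (suc u) zero    = *-nonNeg 0≤a (0≤W u zero)
    0≤W (suc u) (suc v) = +-nonNeg (*-nonNeg 0≤a (0≤W u (suc v))) (*-nonNeg 0≤c (0≤W (suc u) v))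

    w : ℕ → ℕ → ℕ → ℚ
    w i u v = W u v * pow (ρ i) (suc (u ℕ.+ v))

    w-scaled : ∀ i u v → (½ + ι i) * w i u v ≡ W u v * pow (ρ i) (u ℕ.+ v)
    w-scaled i u v = begin
      (½ + ι i) * (W u v * (ρ i * pow (ρ i) (u ℕ.+ v)))      ≡⟨ rearrange (½ + ι i) (W u v) (ρ i) (pow (ρ i) (u ℕ.+ v)) ⟩
      (½ + ι i) * ρ i * (W u v * pow (ρ i) (u ℕ.+ v))        ≡⟨ cong (_* (W u v * pow (ρ i) (u ℕ.+ v))) (ρ-inverse i) ⟩
      1ℚ * (W u v * pow (ρ i) (u ℕ.+ v))                     ≡⟨ *-identityˡ (W u v * pow (ρ i) (u ℕ.+ v)) ⟩
      W u v * pow (ρ i) (u ℕ.+ v)                            ∎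
      where
      open ≡-Reasoning
      rearrange : ∀ x y z t → x * (y * (z * t)) ≡ x * z * (y * t)
      rearrange = solve-∀ ring

    -- The defining equation (1/2 + i - aX - cY) · w = 1, read coefficientwise; `δ u * δ v` is the
    -- constant 1. It reduces to the recursion of `W`, since `w` carries one more power of `ρ i`
    -- than its total degree.
    w-rec : ∀ i u v → (½ + ι i) * w i u v ≡ a * sh (λ u → w i u v) u + c * sh (w i u) v + δ u * δ v
    w-rec i u v = trans (w-scaled i u v) (cases u v)
      where
      cases : ∀ u v → W u v * pow (ρ i) (u ℕ.+ v) ≡ a * sh (λ u → w i u v) u + c * sh (w i u) v + δ u * δ v
      cases zero    zero    = identity a c
        where
        identity : ∀ a c → 1ℚ * 1ℚ ≡ a * 0ℚ + c * 0ℚ + 1ℚ * 1ℚ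
        identity = solve-∀ ring
      cases zero    (suc v) = identity a c (W zero v) (pow (ρ i) (suc v))
        where
        identity : ∀ a c x y → c * x * y ≡ a * 0ℚ + c * (x * y) + 1ℚ * 0ℚ
        identity = solve-∀ ring
      cases (suc u) zero    = identity a c (W u zero) (pow (ρ i) (suc u ℕ.+ 0))
        where
        identity : ∀ a c x y → a * x * y ≡ a * (x * y) + c * 0ℚ + 0ℚ * 1ℚ
        identity = solve-∀ ring
      cases (suc u) (suc v) = trans
        (identity a c (W u (suc v)) (W (suc u) v) (pow (ρ i) (suc u ℕ.+ suc v)))
        (cong (λ k → a * (W u (suc v) * pow (ρ i) (suc u ℕ.+ suc v)) + c * (W (suc u) v * pow (ρ i) (suc k)) + 0ℚ * 0ℚ) (ℕₚ.+-suc u v))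
        where
        identity : ∀ a c x y z → (a * x + c * y) * z ≡ a * (x * z) + c * (y * z) + 0ℚ * 0ℚ
        identity = solve-∀ ring

    -- Partial sums of the expansion 1/(g + i - b) = Σ (b)_n / (g + i)_{n+1}, so `w` is the expected
    -- limit. The term n = 0, which is 1/(g + i), is kept so that the telescoping starts at 1;
    -- `S-positive-part` removes it later.
    S : ℕ → ℕ → ℕ → ℕ → ℚ
    S N i u v = ∑ N (λ n → p n u * q (suc n) i v)

    sh-S : ∀ N i u v → sh (λ u → S (suc N) i u v) u ≡ sh (λ u → S N i u v) u + sh (p N) u * q (suc N) i v
    sh-S N i zero    v = sym (trans (+-identityˡ (0ℚ * q (suc N) i v)) (*-zeroˡ (q (suc N) i v)))
    sh-S N i (suc u) v = refl

    S-sh : ∀ N i u v → sh (S (suc N) i u) v ≡ sh (S N i u) v + p N u * sh (q (suc N) i) v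
    S-sh N i u zero    = sym (trans (+-identityˡ (p N u * 0ℚ)) (*-zeroʳ (p N u)))
    S-sh N i u (suc v) = refl

    -- The relation (g + i − b) D_n = U_n − U_{n+1} between D_n = (b)_n / (g + i)_{n+1} and U_n = (b)_n / (g + i)_n,
    -- summed over n.
    S-rec : ∀ N i u v →
      (½ + ι i) * S N i u v ≡ a * sh (λ u → S N i u v) u + c * sh (S N i u) v + (δ u * δ v - p N u * q N i v)
    S-rec zero i u v = begin
      (½ + ι i) * 0ℚ                                                           ≡⟨ identity (½ + ι i) a c (δ u * δ v) ⟩
      a * 0ℚ + c * 0ℚ + (δ u * δ v - δ u * δ v)
        ≡⟨ cong₂ (λ x y → a * x + c * y + (δ u * δ v - δ u * δ v)) (sym (sh-zero u)) (sym (sh-zero v)) ⟩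
      a * sh (λ _ → 0ℚ) u + c * sh (λ _ → 0ℚ) v + (δ u * δ v - δ u * δ v)      ∎
      where
      open ≡-Reasoning
      identity : ∀ x a c y → x * 0ℚ ≡ a * 0ℚ + c * 0ℚ + (y - y)
      identity = solve-∀ ring
    S-rec (suc N) i u v = begin
      (½ + ι i) * (s + P * Q)
        ≡⟨ split β ½ (ι i) (ι N) s P Q ⟩
      (½ + ι i) * s + (P * ((β + ½ + (ι i + ι N)) * Q) - (ι N + β) * P * Q)
        ≡⟨ cong₂ (λ x y → x + (P * y - (ι N + β) * P * Q)) (S-rec N i u v)
             (trans (cong (λ x → (β + ½ + x) * Q) (sym (ι-+ i N))) (q-suc N i v)) ⟩
      a * s₁ + c * s₂ + (d - P * Q₀) + (P * (Q₀ + c * Q₁) - (ι N + β) * P * Q)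
        ≡⟨ merge a c s₁ s₂ d P Q₀ Q₁ Q (ι N + β) P₁ ⟩
      a * (s₁ + P₁ * Q) + c * (s₂ + P * Q₁) + (d - ((ι N + β) * P + a * P₁) * Q)
        ≡⟨ cong₂ (λ x y → a * x + c * y + (d - ((ι N + β) * P + a * P₁) * Q)) (sh-S N i u v) (S-sh N i u v) ⟨
      a * sh (λ u → S (suc N) i u v) u + c * sh (S (suc N) i u) v + (d - ((ι N + β) * P + a * P₁) * Q)
        ≡⟨ cong (λ x → a * sh (λ u → S (suc N) i u v) u + c * sh (S (suc N) i u) v + (d - x * Q)) (p-suc N u) ⟨
      a * sh (λ u → S (suc N) i u v) u + c * sh (S (suc N) i u) v + (d - p (suc N) u * Q) ∎
      where
      open ≡-Reasoning
      s s₁ s₂ P P₁ Q Q₀ Q₁ d : ℚ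
      s  = S N i u v
      s₁ = sh (λ u → S N i u v) u
      s₂ = sh (S N i u) v
      P  = p N u
      P₁ = sh (p N) u
      Q  = q (suc N) i v
      Q₀ = q N i v
      Q₁ = sh (q (suc N) i) v
      d  = δ u * δ v
      split : ∀ β h i n s P Q → (h + i) * (s + P * Q) ≡ (h + i) * s + (P * ((β + h + (i + n)) * Q) - (n + β) * P * Q)
      split = solve-∀ ring
      merge : ∀ a c s₁ s₂ d P Q₀ Q₁ Q f P₁ →
        a * s₁ + c * s₂ + (d - P * Q₀) + (P * (Q₀ + c * Q₁) - f * P * Q)
        ≡ a * (s₁ + P₁ * Q) + c * (s₂ + P * Q₁) + (d - (f * P + a * P₁) * Q)
      merge = solve-∀ ring

    -- The remainder after N terms, hence the coefficient of the overview's G(N,i): by `E-rec`,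
    -- multiplication by g + i - b turns it into (b)_N / (g + i)_N.
    E : ℕ → ℕ → ℕ → ℕ → ℚ
    E N i u v = w i u v - S N i u v

    sh-E : ∀ N i u v → sh (λ u → E N i u v) u ≡ sh (λ u → w i u v) u - sh (λ u → S N i u v) u
    sh-E N i zero    v = refl
    sh-E N i (suc u) v = refl

    E-sh : ∀ N i u v → sh (E N i u) v ≡ sh (w i u) v - sh (S N i u) v
    E-sh N i u zero    = refl
    E-sh N i u (suc v) = refl

    E-rec : ∀ N i u v → (½ + ι i) * E N i u v ≡ a * sh (λ u → E N i u v) u + c * sh (E N i u) v + p N u * q N i v
    E-rec N i u v = begin
      (½ + ι i) * (w i u v - S N i u v)
        ≡⟨ distrib (½ + ι i) (w i u v) (S N i u v) ⟩
      (½ + ι i) * w i u v - (½ + ι i) * S N i u v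
        ≡⟨ cong₂ _-_ (w-rec i u v) (S-rec N i u v) ⟩
      a * sh (λ u → w i u v) u + c * sh (w i u) v + δ u * δ v
        - (a * sh (λ u → S N i u v) u + c * sh (S N i u) v + (δ u * δ v - p N u * q N i v))
        ≡⟨ collect a c (sh (λ u → w i u v) u) (sh (w i u) v) (δ u * δ v) (sh (λ u → S N i u v) u) (sh (S N i u) v) (p N u * q N i v) ⟩
      a * (sh (λ u → w i u v) u - sh (λ u → S N i u v) u) + c * (sh (w i u) v - sh (S N i u) v) + p N u * q N i v
        ≡⟨ cong₂ (λ x y → a * x + c * y + p N u * q N i v) (sh-E N i u v) (E-sh N i u v) ⟨
      a * sh (λ u → E N i u v) u + c * sh (E N i u) v + p N u * q N i v ∎
      where
      open ≡-Reasoning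
      distrib : ∀ x y z → x * (y - z) ≡ x * y - x * z
      distrib = solve-∀ ring
      collect : ∀ a c w₁ w₂ d s₁ s₂ x →
        a * w₁ + c * w₂ + d - (a * s₁ + c * s₂ + (d - x)) ≡ a * (w₁ - s₁) + c * (w₂ - s₂) + x
      collect = solve-∀ ring

    0<½+ι : ∀ i → 0ℚ < ½ + ι i
    0<½+ι i = +-mono-<-≤ 0<½ (0≤ι i)

    -- Every term on the right of `E-rec` is nonnegative once the lower coefficients are, and 1/2 +
    -- i is positive. The shifted companions carry the induction over `u` and `v`.
    0≤E    : ∀ N i u v → 0ℚ ≤ E N i u v
    0≤sh-E : ∀ N i u v → 0ℚ ≤ sh (λ u → E N i u v) u
    0≤E-sh : ∀ N i u v → 0ℚ ≤ sh (E N i u) v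

    0≤E N i u v = *-cancel-≤ (0<½+ι i) (subst₂ _≤_ (sym (*-zeroʳ (½ + ι i))) (sym (E-rec N i u v))
      (+-nonNeg (+-nonNeg (*-nonNeg 0≤a (0≤sh-E N i u v)) (*-nonNeg 0≤c (0≤E-sh N i u v))) (*-nonNeg (0≤p N u) (0≤q N i v))))

    0≤sh-E N i zero    v = ≤-refl
    0≤sh-E N i (suc u) v = 0≤E N i u v

    0≤E-sh N i u zero    = ≤-refl
    0≤E-sh N i u (suc v) = 0≤E N i u v

    -- A bound uniform in N, which is all that the edge i = N requires; convergence of `S` to `w`
    -- for fixed i is not invoked there.
    S≤w : ∀ N i u v → S N i u v ≤ w i u v
    S≤w N i u v = ≤-by (E N i u v) (0≤E N i u v) (uncancel (w i u v) (S N i u v))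
      where
      uncancel : ∀ x y → x ≡ y + (x - y)
      uncancel = solve-∀ ring

    -- A N u v is the coefficient of X^u Y^v in (b)_N / (g)_N.
    A : ℕ → ℕ → ℕ → ℚ
    A N u v = p N u * q N 0 v

    0≤A : ∀ N u v → 0ℚ ≤ A N u v
    0≤A N u v = *-nonNeg (0≤p N u) (0≤q N 0 v)

    sh-A : ∀ N u v → sh (λ u → A N u v) u ≡ sh (p N) u * q N 0 v
    sh-A N u v = sh-*ʳ (q N 0 v) (p N) u

    A-sh : ∀ N u v → sh (A N u) v ≡ p N u * sh (q N 0) v
    A-sh N u v = sh-*ˡ (p N u) (q N 0) v

    -- Coefficient form of (g + N) A_{N+1} = (b + N) A_N, with the contributions of X and Y moved to
    -- the right as a perturbation.
    A-rec : ∀ N u v → (ι N + β + ½) * A (suc N) u v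
      ≡ (ι N + β) * A N u v + (a * sh (λ u → A N u v) u + c * sh (A (suc N) u) v)
    A-rec N u v = begin
      (ι N + β + ½) * (p (suc N) u * q (suc N) 0 v)
        ≡⟨ regroup (ι N) β ½ (p (suc N) u) (q (suc N) 0 v) ⟩
      p (suc N) u * (g N * q (suc N) 0 v)
        ≡⟨ cong (p (suc N) u *_) (q-suc N 0 v) ⟩
      p (suc N) u * (q N 0 v + c * sh (q (suc N) 0) v)
        ≡⟨ expand (p (suc N) u) (q N 0 v) c (sh (q (suc N) 0) v) ⟩
      p (suc N) u * q N 0 v + c * (p (suc N) u * sh (q (suc N) 0) v)
        ≡⟨ cong₂ (λ x y → x * q N 0 v + c * y) (p-suc N u) (sym (A-sh (suc N) u v)) ⟩
      ((ι N + β) * p N u + a * sh (p N) u) * q N 0 v + c * sh (A (suc N) u) v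
        ≡⟨ distrib (ι N + β) (p N u) a (sh (p N) u) (q N 0 v) (c * sh (A (suc N) u) v) ⟩
      (ι N + β) * A N u v + (a * (sh (p N) u * q N 0 v) + c * sh (A (suc N) u) v)
        ≡⟨ cong (λ x → (ι N + β) * A N u v + (a * x + c * sh (A (suc N) u) v)) (sh-A N u v) ⟨
      (ι N + β) * A N u v + (a * sh (λ u → A N u v) u + c * sh (A (suc N) u) v) ∎
      where
      open ≡-Reasoning
      regroup : ∀ n β h p q → (n + β + h) * (p * q) ≡ p * ((β + h + n) * q)
      regroup = solve-∀ ring
      expand : ∀ p q c s → p * (q + c * s) ≡ p * q + c * (p * s)
      expand = solve-∀ ring
      distrib : ∀ f p a s q t → (f * p + a * s) * q + t ≡ f * (p * q) + (a * (s * q) + t)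
      distrib = solve-∀ ring

    β≤1 : β ≤ 1ℚ
    β≤1 = ≤-trans β≤½ (≤-by ½ 0≤½ refl)

    -- Induction on the two indices: the perturbation in `A-rec` involves only coefficients of lower
    -- degree, which are already null. The gap 1/2 that `contraction-null` exploits is the constant
    -- term of g - b.
    A-null    : ∀ u v → Null (λ N → A N u v)
    sh-A-null : ∀ u v → Null (λ N → sh (λ u → A N u v) u)
    A-sh-null : ∀ u v → Null (λ N → sh (A N u) v)

    A-null u v = contraction-null {β} {λ N → A N u v} {λ N → a * sh (λ u → A N u v) u + c * sh (A (suc N) u) v} 0≤β β≤1
      (λ N → 0≤A N u v) (λ N → ≤-reflexive (A-rec N u v))
      (null-+ (null-* a (sh-A-null u v)) (null-* c (null-shift (A-sh-null u v))))

    sh-A-null zero    v = null-zero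
    sh-A-null (suc u) v = A-null u v

    A-sh-null u zero    = null-zero
    A-sh-null u (suc v) = A-null u v

    -- The edge n = N + 1 of the square

    V : ℕ → ℕ → ℕ → ℚ
    V N u v = p (suc N) u * ∑ N (λ i → q (suc N) i v)

    -- Telescoping bounds M times the sum over i by `q M 0 v`, with M = N + 1. The factor 1/M gained
    -- in this way offsets the growth factor M + β from (b)_M to (b)_{M+1}, leaving a constant
    -- multiple of null sequences.
    V≤ : ∀ N u v → V (suc N) u v ≤ ι 2 * A (suc N) u v + a * sh (λ u → A (suc N) u v) u
    V≤ N u v = *-cancel-≤ (0<ι N) (begin
      ι M * (p (suc M) u * ∑ M (λ i → q (suc M) i v))              ≡⟨ swap (ι M) (p (suc M) u) (∑ M (λ i → q (suc M) i v)) ⟩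
      p (suc M) u * (ι M * ∑ M (λ i → q (suc M) i v))              ≤⟨ *-monoˡ (0≤p (suc M) u) (≤-by (q M M v) (0≤q M M v)
                                                                        (trans (q-telescope M M v) (+-comm (q M M v) (ι M * ∑ M (λ i → q (suc M) i v))))) ⟩
      p (suc M) u * q M 0 v                                        ≡⟨ cong (_* q M 0 v) (p-suc M u) ⟩
      ((ι M + β) * p M u + a * sh (p M) u) * q M 0 v               ≡⟨ distrib (ι M + β) (p M u) a (sh (p M) u) (q M 0 v) ⟩
      (ι M + β) * A M u v + 1ℚ * (a * (sh (p M) u * q M 0 v))      ≤⟨ +-mono-≤ (*-monoʳ (0≤A M u v) ιM+β≤)
                                                                        (*-monoʳ (*-nonNeg 0≤a (*-nonNeg (sh-nonNeg (0≤p M) u) (0≤q M 0 v))) 1≤ιM) ⟩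
      (ι M + ι M) * A M u v + ι M * (a * (sh (p M) u * q M 0 v))   ≡⟨ factor (ι M) (A M u v) (a * (sh (p M) u * q M 0 v)) ⟩
      ι M * (ι 2 * A M u v + a * (sh (p M) u * q M 0 v))           ≡⟨ cong (λ x → ι M * (ι 2 * A M u v + a * x)) (sh-A M u v) ⟨
      ι M * (ι 2 * A M u v + a * sh (λ u → A M u v) u)             ∎)
      where
      open ≤-Reasoning
      M : ℕ
      M = suc N
      1≤ιM : 1ℚ ≤ ι M
      1≤ιM = ι-mono (ℕ.s≤s (ℕ.z≤n {N}))
      ιM+β≤ : ι M + β ≤ ι M + ι M
      ιM+β≤ = +-monoʳ-≤ (ι M) (≤-trans β≤1 1≤ιM)
      swap : ∀ x y z → x * (y * z) ≡ y * (x * z)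
      swap = solve-∀ ring
      distrib : ∀ f p a s q → (f * p + a * s) * q ≡ f * (p * q) + 1ℚ * (a * (s * q))
      distrib = solve-∀ ring
      factor : ∀ m x y → (m + m) * x + m * y ≡ m * (ι 2 * x + y)
      factor = solve-∀ ring

    0≤V : ∀ N u v → 0ℚ ≤ V N u v
    0≤V N u v = *-nonNeg (0≤p (suc N) u) (∑-nonNeg N (λ i → 0≤q (suc N) i v))

    V-null : ∀ u v → Null (λ N → V N u v)
    V-null u v = null-unshift (null-squeeze 0 (λ N _ → 0≤V (suc N) u v) (λ N _ → V≤ N u v)
      (null-shift (null-+ (null-* (ι 2) (A-null u v)) (null-* a (sh-A-null u v)))))

    -- The contribution Σ_i G(N+1,i) of this edge.
    T : ℕ → ℕ → ℕ → ℚ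
    T N u v = ∑ N (λ i → E (suc N) i u v)

    0≤T : ∀ N u v → 0ℚ ≤ T N u v
    0≤T N u v = ∑-nonNeg N (λ i → 0≤E (suc N) i u v)

    -- Lowering 1/2 + i to 1/2 makes the factor independent of i, so `E-rec` can be summed over i.
    -- The source terms add up to `V`, and the rest has lower degree, which lets `T-null` proceed by
    -- induction.
    ½T≤ : ∀ N u v → ½ * T N u v ≤ a * sh (λ u → T N u v) u + c * sh (T N u) v + V N u v
    ½T≤ N u v = begin
      ½ * ∑ N (λ i → E M i u v)
        ≡⟨ ∑-*ˡ N ½ (λ i → E M i u v) ⟨
      ∑ N (λ i → ½ * E M i u v)
        ≤⟨ ∑-mono N (λ i → *-monoʳ (0≤E M i u v) (≤-by {½} {½ + ι i} (ι i) (0≤ι i) refl)) ⟩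
      ∑ N (λ i → (½ + ι i) * E M i u v)
        ≡⟨ ∑-cong N (λ i → E-rec M i u v) ⟩
      ∑ N (λ i → a * sh (λ u → E M i u v) u + c * sh (E M i u) v + p M u * q M i v)
        ≡⟨ trans (∑-+ N (λ i → a * sh (λ u → E M i u v) u + c * sh (E M i u) v) (λ i → p M u * q M i v))
                 (cong₂ _+_ (∑-+ N (λ i → a * sh (λ u → E M i u v) u) (λ i → c * sh (E M i u) v)) (∑-*ˡ N (p M u) (λ i → q M i v))) ⟩
      ∑ N (λ i → a * sh (λ u → E M i u v) u) + ∑ N (λ i → c * sh (E M i u) v) + V N u v
        ≡⟨ cong₂ (λ x y → x + y + V N u v) (∑-*ˡ N a (λ i → sh (λ u → E M i u v) u)) (∑-*ˡ N c (λ i → sh (E M i u) v)) ⟩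
      a * ∑ N (λ i → sh (λ u → E M i u v) u) + c * ∑ N (λ i → sh (E M i u) v) + V N u v
        ≡⟨ cong₂ (λ x y → a * x + c * y + V N u v) (sh-∑ N (λ i u → E M i u v) u) (sh-∑ N (λ i → E M i u) v) ⟨
      a * sh (λ u → T N u v) u + c * sh (T N u) v + V N u v ∎
      where
      open ≤-Reasoning
      M : ℕ
      M = suc N

    T-null    : ∀ u v → Null (λ N → T N u v)
    sh-T-null : ∀ u v → Null (λ N → sh (λ u → T N u v) u)
    T-sh-null : ∀ u v → Null (λ N → sh (T N u) v)

    T-null u v = null-squeeze 0 (λ N _ → 0≤T N u v)
      (λ N _ → *-cancel-≤ 0<½ (≤-trans (½T≤ N u v) (≤-reflexive (double (a * sh (λ u → T N u v) u + c * sh (T N u) v + V N u v)))))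
      (null-* (ι 2) (null-+ (null-+ (null-* a (sh-T-null u v)) (null-* c (T-sh-null u v))) (V-null u v)))
      where
      double : ∀ x → x ≡ ½ * (ι 2 * x)
      double = solve-∀ ring

    sh-T-null zero    v = null-zero
    sh-T-null (suc u) v = T-null u v

    T-sh-null u zero    = null-zero
    T-sh-null u (suc v) = T-null u v

    -- Telescoping over the square and passage to the limit

    F : ℕ → ℕ → ℕ → ℕ → ℚ
    F n i u v = p n u * q n i v * inv n

    0≤F : ∀ n i u v → 0ℚ ≤ F n i u v
    0≤F n i u v = *-nonNeg (*-nonNeg (0≤p n u) (0≤q n i v)) (0≤inv n)

    -- The factor n produced by `q-telescope` cancels the 1/n in `F`.
    F-telescope : ∀ n J u v → F (suc n) 0 u v ≡ F (suc n) J u v + ∑ J (λ i → p (suc n) u * q (suc (suc n)) i v)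
    F-telescope n J u v = begin
      P * q N 0 v * inv N                                ≡⟨ cong (λ x → P * x * inv N) (q-telescope N J v) ⟩
      P * (q N J v + ι N * s) * inv N                    ≡⟨ distrib P (q N J v) (ι N) s (inv N) ⟩
      P * q N J v * inv N + ι N * inv N * (P * s)        ≡⟨ cong (λ x → P * q N J v * inv N + x * (P * s)) (ι*inv n) ⟩
      P * q N J v * inv N + 1ℚ * (P * s)                 ≡⟨ cong (P * q N J v * inv N +_) (trans (*-identityˡ (P * s))
                                                              (sym (∑-*ˡ J P (λ i → q (suc N) i v)))) ⟩
      P * q N J v * inv N + ∑ J (λ i → P * q (suc N) i v) ∎
      where
      open ≡-Reasoning
      N : ℕ
      N = suc n
      P s : ℚ
      P = p N u
      s = ∑ J (λ i → q (suc N) i v)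
      distrib : ∀ P x m s i → P * (x + m * s) * i ≡ P * x * i + m * i * (P * s)
      distrib = solve-∀ ring

    -- (b)_0 = 1 has no positive power of X, so the term n = 0 vanishes. This is how 1/(g + i) drops
    -- out, and it is the reason why the X-index is a successor from here on.
    S-positive-part : ∀ N i u v → S (suc N) i (suc u) v ≡ ∑ N (λ n → p (suc n) (suc u) * q (suc (suc n)) i v)
    S-positive-part N i u v = trans (∑-split 1 N (λ n → p n (suc u) * q (suc n) i v))
      (vanish (q 1 i v) (∑ N (λ n → p (suc n) (suc u) * q (suc (suc n)) i v)))
      where
      vanish : ∀ x y → 0ℚ + 0ℚ * x + y ≡ y
      vanish = solve-∀ ring

    ∑F-telescope : ∀ N u v →
      ∑ N (λ n → F (suc n) 0 (suc u) v) ≡ ∑ N (λ n → F (suc n) N (suc u) v) + ∑ N (λ i → S (suc N) i (suc u) v)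
    ∑F-telescope N u v = begin
      ∑ N (λ n → F (suc n) 0 (suc u) v)
        ≡⟨ ∑-cong N (λ n → F-telescope n N (suc u) v) ⟩
      ∑ N (λ n → F (suc n) N (suc u) v + ∑ N (λ i → p (suc n) (suc u) * q (suc (suc n)) i v))
        ≡⟨ ∑-+ N (λ n → F (suc n) N (suc u) v) (λ n → ∑ N (λ i → p (suc n) (suc u) * q (suc (suc n)) i v)) ⟩
      ∑ N (λ n → F (suc n) N (suc u) v) + ∑ N (λ n → ∑ N (λ i → p (suc n) (suc u) * q (suc (suc n)) i v))
        ≡⟨ cong (∑ N (λ n → F (suc n) N (suc u) v) +_) (trans (∑-swap N N (λ n i → p (suc n) (suc u) * q (suc (suc n)) i v))
             (∑-cong N (λ i → sym (S-positive-part N i u v)))) ⟩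
      ∑ N (λ n → F (suc n) N (suc u) v) + ∑ N (λ i → S (suc N) i (suc u) v) ∎
      where open ≡-Reasoning

    -- As β ≤ 1/2, one has g i ≤ 1 + i ≤ 2 (1/2 + i).
    g*ρ≤2 : ∀ i → g i * ρ i ≤ ι 2
    g*ρ≤2 i = begin
      (β + ½ + ι i) * ρ i              ≤⟨ *-monoʳ (0≤ρ i) (+-monoˡ-≤ (ι i) (+-monoˡ-≤ ½ β≤½)) ⟩
      (½ + ½ + ι i) * ρ i              ≤⟨ *-monoʳ (0≤ρ i) (≤-by {½ + ½ + ι i} {ι 2 * (½ + ι i)} (ι i) (0≤ι i) (double (ι i))) ⟩
      ι 2 * (½ + ι i) * ρ i            ≡⟨ *-assoc (ι 2) (½ + ι i) (ρ i) ⟩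
      ι 2 * ((½ + ι i) * ρ i)          ≡⟨ cong (ι 2 *_) (ρ-inverse i) ⟩
      ι 2 * 1ℚ                         ≡⟨ *-identityʳ (ι 2) ⟩
      ι 2                              ∎
      where
      open ≤-Reasoning
      double : ∀ x → ι 2 * (½ + x) ≡ ½ + ½ + x + x
      double = solve-∀ ring

    -- Dropping the factor 1/n and the Y-part in `q-left` bounds F(n, J+1) by `g J` times a term of
    -- `S` at i = J, and `S≤w` bounds the whole sum. A positive X-index gives `w` at least two
    -- factors `ρ J`: one absorbs `g J`, another tends to 0, and any further ones are at most 2.
    ∑F-boundary≤ : ∀ J u v → ∑ (suc J) (λ n → F (suc n) (suc J) (suc u) v) ≤ W (suc u) v * (ι 2 * (ρ J * pow (ι 2) (u ℕ.+ v)))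
    ∑F-boundary≤ J u v = begin
      ∑ N (λ n → F (suc n) N (suc u) v)
        ≤⟨ ∑-mono N term≤ ⟩
      ∑ N (λ n → g J * (p (suc n) (suc u) * q (suc (suc n)) J v))
        ≡⟨ ∑-*ˡ N (g J) (λ n → p (suc n) (suc u) * q (suc (suc n)) J v) ⟩
      g J * ∑ N (λ n → p (suc n) (suc u) * q (suc (suc n)) J v)
        ≡⟨ cong (g J *_) (S-positive-part N J u v) ⟨
      g J * S (suc N) J (suc u) v
        ≤⟨ *-monoˡ (<⇒≤ (0<g J)) (S≤w (suc N) J (suc u) v) ⟩
      g J * (W (suc u) v * (ρ J * (ρ J * pow (ρ J) (u ℕ.+ v))))
        ≡⟨ regroup (g J) (W (suc u) v) (ρ J) (pow (ρ J) (u ℕ.+ v)) ⟩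
      W (suc u) v * (g J * ρ J * (ρ J * pow (ρ J) (u ℕ.+ v)))
        ≤⟨ *-monoˡ (0≤W (suc u) v) (*-monoʳ (*-nonNeg (0≤ρ J) (pow-nonNeg (0≤ρ J) (u ℕ.+ v))) (g*ρ≤2 J)) ⟩
      W (suc u) v * (ι 2 * (ρ J * pow (ρ J) (u ℕ.+ v)))
        ≤⟨ *-monoˡ (0≤W (suc u) v) (*-monoˡ (0≤ι 2) (*-monoˡ (0≤ρ J) (pow-mono (0≤ρ J) (ρ≤2 J) (u ℕ.+ v)))) ⟩
      W (suc u) v * (ι 2 * (ρ J * pow (ι 2) (u ℕ.+ v))) ∎
      where
      open ≤-Reasoning
      N : ℕ
      N = suc J
      regroup : ∀ g w r x → g * (w * (r * (r * x))) ≡ w * (g * r * (r * x))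
      regroup = solve-∀ ring
      swap : ∀ x y z → x * (y * z) ≡ y * (x * z)
      swap = solve-∀ ring
      term≤ : ∀ n → F (suc n) N (suc u) v ≤ g J * (p (suc n) (suc u) * q (suc (suc n)) J v)
      term≤ n = begin
        P * q (suc n) N v * inv (suc n)        ≤⟨ *-monoˡ (*-nonNeg (0≤p (suc n) (suc u)) (0≤q (suc n) N v)) (inv-antimono {0} {suc n} (ℕ.s≤s ℕ.z≤n)) ⟩
        P * q (suc n) N v * 1ℚ                 ≡⟨ *-identityʳ (P * q (suc n) N v) ⟩
        P * q (suc n) N v                      ≤⟨ *-monoˡ (0≤p (suc n) (suc u)) (≤-by (c * sh (q (suc (suc n)) J) v)
                                                    (*-nonNeg 0≤c (sh-nonNeg (0≤q (suc (suc n)) J) v)) (sym (q-left (suc n) J v))) ⟩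
        P * (g J * q (suc (suc n)) J v)        ≡⟨ swap P (g J) (q (suc (suc n)) J v) ⟩
        g J * (P * q (suc (suc n)) J v)        ∎
        where
        P : ℚ
        P = p (suc n) (suc u)

    ∑F-boundary-null : ∀ u v → Null (λ N → ∑ N (λ n → F (suc n) N (suc u) v))
    ∑F-boundary-null u v = null-unshift (null-squeeze 0
      (λ J _ → ∑-nonNeg (suc J) (λ n → 0≤F (suc n) (suc J) (suc u) v))
      (λ J _ → ∑F-boundary≤ J u v)
      (null-* (W (suc u) v) (null-* (ι 2) (null-cong (λ J → *-comm (ρ J) (pow (ι 2) (u ℕ.+ v))) (null-* (pow (ι 2) (u ℕ.+ v)) null-ρ)))))

    ∑F-limit : ∀ u v → Null (λ N → ∑ N (λ n → F (suc n) 0 (suc u) v) - W (suc u) v * ∑ N (λ i → pow (ρ i) (suc u ℕ.+ v ℕ.+ 1)))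
    ∑F-limit u v = null-cong decompose (null-+ (∑F-boundary-null u v) (null-* (- 1ℚ) (T-null (suc u) v)))
      where
      open ≡-Reasoning
      regroup : ∀ b s x → b + s - x ≡ b + - 1ℚ * (x - s)
      regroup = solve-∀ ring
      decompose : ∀ N → ∑ N (λ n → F (suc n) 0 (suc u) v) - W (suc u) v * ∑ N (λ i → pow (ρ i) (suc u ℕ.+ v ℕ.+ 1))
        ≡ ∑ N (λ n → F (suc n) N (suc u) v) + - 1ℚ * T N (suc u) v
      decompose N = begin
        ∑ N (λ n → F (suc n) 0 (suc u) v) - W (suc u) v * ∑ N (λ i → pow (ρ i) (suc u ℕ.+ v ℕ.+ 1))
          ≡⟨ cong₂ _-_ (∑F-telescope N u v) (cong (λ s → W (suc u) v * ∑ N (λ i → pow (ρ i) s)) (ℕₚ.+-comm (suc u ℕ.+ v) 1)) ⟩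
        ∑ N (λ n → F (suc n) N (suc u) v) + ∑ N (λ i → S (suc N) i (suc u) v) - W (suc u) v * ∑ N (λ i → pow (ρ i) (suc (suc u ℕ.+ v)))
          ≡⟨ cong (λ x → ∑ N (λ n → F (suc n) N (suc u) v) + ∑ N (λ i → S (suc N) i (suc u) v) - x)
               (∑-*ˡ N (W (suc u) v) (λ i → pow (ρ i) (suc (suc u ℕ.+ v)))) ⟨
        ∑ N (λ n → F (suc n) N (suc u) v) + ∑ N (λ i → S (suc N) i (suc u) v) - ∑ N (λ i → w i (suc u) v)
          ≡⟨ regroup (∑ N (λ n → F (suc n) N (suc u) v)) (∑ N (λ i → S (suc N) i (suc u) v)) (∑ N (λ i → w i (suc u) v)) ⟩
        ∑ N (λ n → F (suc n) N (suc u) v) + - 1ℚ * (∑ N (λ i → w i (suc u) v) - ∑ N (λ i → S (suc N) i (suc u) v))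
          ≡⟨ cong (λ x → ∑ N (λ n → F (suc n) N (suc u) v) + - 1ℚ * x) (∑-sub N (λ i → w i (suc u) v) (λ i → S (suc N) i (suc u) v)) ⟨
        ∑ N (λ n → F (suc n) N (suc u) v) + - 1ℚ * T N (suc u) v ∎

    -- The recursion of `W` is Pascal's rule with weight a for each step in u and c for each step in
    -- v.
    W-binomial : ∀ u v → W u v ≡ ι ((u ℕ.+ v) C u) * (pow a u * pow c v)
    W-binomial zero    zero    = refl
    W-binomial zero    (suc v) = begin
      c * W zero v                                    ≡⟨ cong (c *_) (W-binomial zero v) ⟩
      c * (ι (v C 0) * (1ℚ * pow c v))                ≡⟨ cong (λ k → c * (ι k * (1ℚ * pow c v))) (trans (nC0≡1 v) (sym (nC0≡1 (suc v)))) ⟩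
      c * (ι (suc v C 0) * (1ℚ * pow c v))            ≡⟨ rearrange c (ι (suc v C 0)) 1ℚ (pow c v) ⟩
      ι (suc v C 0) * (1ℚ * (c * pow c v))            ∎
      where
      open ≡-Reasoning
      rearrange : ∀ c k x y → c * (k * (x * y)) ≡ k * (x * (c * y))
      rearrange = solve-∀ ring
    W-binomial (suc u) zero    = begin
      a * W u zero                                           ≡⟨ cong (a *_) (W-binomial u zero) ⟩
      a * (ι ((u ℕ.+ 0) C u) * (pow a u * 1ℚ))               ≡⟨ cong (λ k → a * (ι k * (pow a u * 1ℚ))) (trans (one u) (sym (one (suc u)))) ⟩
      a * (ι ((suc u ℕ.+ 0) C suc u) * (pow a u * 1ℚ))       ≡⟨ rearrange a (ι ((suc u ℕ.+ 0) C suc u)) (pow a u) 1ℚ ⟩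
      ι ((suc u ℕ.+ 0) C suc u) * (a * pow a u * 1ℚ)         ∎
      where
      open ≡-Reasoning
      one : ∀ u → (u ℕ.+ 0) C u ≡ 1
      one u = trans (cong (_C u) (ℕₚ.+-identityʳ u)) (nCn≡1 u)
      rearrange : ∀ a k x y → a * (k * (x * y)) ≡ k * (a * x * y)
      rearrange = solve-∀ ring
    W-binomial (suc u) (suc v) = begin
      a * W u (suc v) + c * W (suc u) v
        ≡⟨ cong₂ (λ x y → a * x + c * y) (W-binomial u (suc v)) (W-binomial (suc u) v) ⟩
      a * (ι ((u ℕ.+ suc v) C u) * (A′ * (c * C′))) + c * (ι ((suc u ℕ.+ v) C suc u) * (a * A′ * C′))
        ≡⟨ cong (λ k → a * (ι ((u ℕ.+ suc v) C u) * (A′ * (c * C′))) + c * (ι (k C suc u) * (a * A′ * C′))) (ℕₚ.+-suc u v) ⟨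
      a * (ι ((u ℕ.+ suc v) C u) * (A′ * (c * C′))) + c * (ι ((u ℕ.+ suc v) C suc u) * (a * A′ * C′))
        ≡⟨ collect a c A′ C′ (ι ((u ℕ.+ suc v) C u)) (ι ((u ℕ.+ suc v) C suc u)) ⟩
      (ι ((u ℕ.+ suc v) C u) + ι ((u ℕ.+ suc v) C suc u)) * (a * A′ * (c * C′))
        ≡⟨ cong (_* (a * A′ * (c * C′))) (trans (sym (ι-+ ((u ℕ.+ suc v) C u) ((u ℕ.+ suc v) C suc u)))
             (cong ι (nCk+nC[k+1]≡[n+1]C[k+1] (u ℕ.+ suc v) u))) ⟩
      ι ((suc u ℕ.+ suc v) C suc u) * (a * A′ * (c * C′)) ∎
      where
      open ≡-Reasoning
      A′ C′ : ℚ
      A′ = pow a u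
      C′ = pow c v
      collect : ∀ a c A′ C′ x y → a * (x * (A′ * (c * C′))) + c * (y * (a * A′ * C′)) ≡ (x + y) * (a * A′ * (c * C′))
      collect = solve-∀ ring

    F-series : ∀ u v → let s = suc u ℕ.+ v ℕ.+ 1 in
      SeriesEqζ (λ n → F n 0 (suc u) v) (W (suc u) v * ι (2 ^ s ∸ 1)) s
    F-series u v = SeriesEqζ-odd (λ n → F n 0 (suc u) v) (W (suc u) v) (suc u ℕ.+ v ℕ.+ 1)
      (ℕ.s≤s (ℕₚ.m≤n+m 1 (u ℕ.+ v))) (∑F-limit u v)

  -- The two specialisations

  1+ι*inv : ∀ j → (½ + ½ + ι j) * inv (suc j) ≡ 1ℚ
  1+ι*inv j = trans (cong (_* inv (suc j)) (sym (ι-suc j))) (ι*inv j)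

  -- `T₁` has b = X and g = (1 - Y)/2, so X marks m and Y marks k. `T₂` has b = (1 + X)/2 and g = 1
  -- - Y, so the roles are exchanged: X marks k and Y marks m.
  module T₁ = WZ 0ℚ 1ℚ ½ ≤-refl 0≤½ 0≤1 0≤½ ρ ρ-inverse
  module T₂ = WZ ½ ½ 1ℚ 0≤½ ≤-refl 0≤½ 0≤1 (inv ∘ suc) 1+ι*inv

  -- Coefficients of the two specialisations as multiple harmonic sums

  p₁-constant : ∀ n → T₁.p (suc n) 0 ≡ 0ℚ
  p₁-constant zero    = refl
  p₁-constant (suc n) = trans (cong ((ι (suc n) + 0ℚ) *_) (p₁-constant n)) (*-zeroʳ (ι (suc n) + 0ℚ))

  -- (X)_{n+1} = n! · X · Π (1 + X/j) over 1 ≤ j ≤ n, and the coefficients of the product are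
  -- elementary symmetric functions of the 1/j. The leading X accounts for the shift in m.
  p₁-ζ : ∀ n m → T₁.p (suc n) (suc m) ≡ ι (n !) * ζₙ m n
  p₁-ζ zero    zero    = refl
  p₁-ζ zero    (suc m) = refl
  p₁-ζ (suc n) zero    = begin
    (ι (suc n) + 0ℚ) * T₁.p (suc n) 1 + 1ℚ * T₁.p (suc n) 0      ≡⟨ cong₂ (λ x y → (ι (suc n) + 0ℚ) * x + 1ℚ * y) (p₁-ζ n zero) (p₁-constant n) ⟩
    (ι (suc n) + 0ℚ) * (ι (n !) * 1ℚ) + 1ℚ * 0ℚ                  ≡⟨ simplify (ι (suc n)) (ι (n !)) ⟩
    ι (suc n) * ι (n !) * 1ℚ                                     ≡⟨ cong (_* 1ℚ) (ι-* (suc n) (n !)) ⟨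
    ι (suc n !) * 1ℚ                                             ∎
    where
    open ≡-Reasoning
    simplify : ∀ x y → (x + 0ℚ) * (y * 1ℚ) + 1ℚ * 0ℚ ≡ x * y * 1ℚ
    simplify = solve-∀ ring
  p₁-ζ (suc n) (suc m) = begin
    (ι N + 0ℚ) * T₁.p N (suc (suc m)) + 1ℚ * T₁.p N (suc m)             ≡⟨ cong₂ (λ x y → (ι N + 0ℚ) * x + 1ℚ * y) (p₁-ζ n (suc m)) (p₁-ζ n m) ⟩
    (ι N + 0ℚ) * (ι (n !) * z₁) + 1ℚ * (ι (n !) * z₀)                   ≡⟨ expand (ι N) (ι (n !)) z₁ z₀ ⟩
    ι N * ι (n !) * z₁ + 1ℚ * (ι (n !) * z₀)                            ≡⟨ cong (λ x → ι N * ι (n !) * z₁ + x * (ι (n !) * z₀)) (ι*inv n) ⟨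
    ι N * ι (n !) * z₁ + ι N * inv N * (ι (n !) * z₀)                   ≡⟨ collect (ι N) (ι (n !)) z₁ (inv N) z₀ ⟩
    ι N * ι (n !) * (z₁ + inv N * z₀)                                   ≡⟨ cong (_* (z₁ + inv N * z₀)) (ι-* N (n !)) ⟨
    ι (N !) * (z₁ + inv N * z₀)                                         ∎
    where
    open ≡-Reasoning
    N : ℕ
    N = suc n
    z₀ z₁ : ℚ
    z₀ = ζₙ m n
    z₁ = ζₙ (suc m) n
    expand : ∀ x y z₁ z₀ → (x + 0ℚ) * (y * z₁) + 1ℚ * (y * z₀) ≡ x * y * z₁ + 1ℚ * (y * z₀)
    expand = solve-∀ ring
    collect : ∀ x y z₁ i z₀ → x * y * z₁ + x * i * (y * z₀) ≡ x * y * (z₁ + i * z₀)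
    collect = solve-∀ ring

  -- After its constant term is removed, 1/((1 - Y)/2)_n is the product of 1/(1 - Y/(2j - 1)), which
  -- generates complete symmetric functions; hence the weak inequalities in `t⋆ₙ`.
  q₁-t⋆ : ∀ n k → T₁.q n 0 k ≡ T₁.q n 0 0 * t⋆ₙ k n
  q₁-t⋆ zero    zero    = refl
  q₁-t⋆ zero    (suc k) = refl
  q₁-t⋆ (suc n) zero    = sym (*-identityʳ (T₁.q (suc n) 0 0))
  q₁-t⋆ (suc n) (suc k) = begin
    ρ n * (T₁.q n 0 (suc k) + ½ * T₁.q (suc n) 0 k)
      ≡⟨ cong₂ (λ x y → ρ n * (x + ½ * y)) (q₁-t⋆ n (suc k)) (q₁-t⋆ (suc n) k) ⟩
    ρ n * (Q * t⋆ₙ (suc k) n + ½ * (ρ n * Q * t⋆ₙ k (suc n)))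
      ≡⟨ regroup (inv (suc (2 ℕ.* n))) Q (t⋆ₙ (suc k) n) (t⋆ₙ k (suc n)) ⟩
    ρ n * Q * (t⋆ₙ (suc k) n + inv (suc (2 ℕ.* n)) * t⋆ₙ k (suc n))
      ≡⟨ cong (λ j → ρ n * Q * (t⋆ₙ (suc k) n + inv j * t⋆ₙ k (suc n))) (2*suc∸1 n) ⟨
    ρ n * Q * (t⋆ₙ (suc k) n + inv (2 ℕ.* suc n ∸ 1) * t⋆ₙ k (suc n)) ∎
    where
    open ≡-Reasoning
    Q : ℚ
    Q = T₁.q n 0 0
    regroup : ∀ i Q x y → ι 2 * i * (Q * x + ½ * (ι 2 * i * Q * y)) ≡ ι 2 * i * Q * (x + i * y)
    regroup = solve-∀ ring

  -- Each factor of ((1 + X)/2)_n is (j - 1/2)(1 + X/(2j - 1)), so elementary symmetric functions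
  -- appear.
  p₂-t : ∀ n k → T₂.p n k ≡ T₂.p n 0 * tₙ k n
  p₂-t zero    zero    = refl
  p₂-t zero    (suc k) = refl
  p₂-t (suc n) zero    = sym (*-identityʳ (T₂.p (suc n) 0))
  p₂-t (suc n) (suc k) = begin
    (ι n + ½) * T₂.p n (suc k) + ½ * T₂.p n k
      ≡⟨ cong₂ (λ x y → (ι n + ½) * x + ½ * y) (p₂-t n (suc k)) (p₂-t n k) ⟩
    (ι n + ½) * (P * tₙ (suc k) n) + ½ * (P * tₙ k n)
      ≡⟨ cong (λ x → (ι n + ½) * (P * tₙ (suc k) n) + x) (trans (cong (_* (½ * (P * tₙ k n))) (ρ-inverse n)) (*-identityˡ (½ * (P * tₙ k n)))) ⟨
    (ι n + ½) * (P * tₙ (suc k) n) + (½ + ι n) * ρ n * (½ * (P * tₙ k n))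
      ≡⟨ regroup (ι n) P (tₙ (suc k) n) (tₙ k n) (inv (suc (2 ℕ.* n))) ⟩
    (ι n + ½) * P * (tₙ (suc k) n + inv (suc (2 ℕ.* n)) * tₙ k n)
      ≡⟨ cong (λ j → (ι n + ½) * P * (tₙ (suc k) n + inv j * tₙ k n)) (2*suc∸1 n) ⟨
    (ι n + ½) * P * (tₙ (suc k) n + inv (2 ℕ.* suc n ∸ 1) * tₙ k n) ∎
    where
    open ≡-Reasoning
    P : ℚ
    P = T₂.p n 0
    regroup : ∀ n P x y i → (n + ½) * (P * x) + (½ + n) * (ι 2 * i) * (½ * (P * y)) ≡ (n + ½) * P * (x + i * y)
    regroup = solve-∀ ring

  -- Each factor of 1/(1 - Y)_n is (1/j) · 1/(1 - Y/j), so complete symmetric functions appear.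
  q₂-ζ⋆ : ∀ n m → T₂.q n 0 m ≡ T₂.q n 0 0 * ζ⋆ₙ m n
  q₂-ζ⋆ zero    zero    = refl
  q₂-ζ⋆ zero    (suc m) = refl
  q₂-ζ⋆ (suc n) zero    = sym (*-identityʳ (T₂.q (suc n) 0 0))
  q₂-ζ⋆ (suc n) (suc m) = begin
    inv (suc n) * (T₂.q n 0 (suc m) + 1ℚ * T₂.q (suc n) 0 m)
      ≡⟨ cong₂ (λ x y → inv (suc n) * (x + 1ℚ * y)) (q₂-ζ⋆ n (suc m)) (q₂-ζ⋆ (suc n) m) ⟩
    inv (suc n) * (R * ζ⋆ₙ (suc m) n + 1ℚ * (inv (suc n) * R * ζ⋆ₙ m (suc n)))
      ≡⟨ regroup (inv (suc n)) R (ζ⋆ₙ (suc m) n) (ζ⋆ₙ m (suc n)) ⟩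
    inv (suc n) * R * (ζ⋆ₙ (suc m) n + inv (suc n) * ζ⋆ₙ m (suc n)) ∎
    where
    open ≡-Reasoning
    R : ℚ
    R = T₂.q n 0 0
    regroup : ∀ i R x y → i * (R * x + 1ℚ * (i * R * y)) ≡ i * R * (x + i * y)
    regroup = solve-∀ ring

  -- Constant terms as central binomial coefficients

  q₁-factorial : ∀ n → T₁.q n 0 0 * ι ((2 ℕ.* n) !) ≡ ι (4 ^ n) * ι (n !)
  q₁-factorial zero    = refl
  q₁-factorial (suc n) = begin
    ρ n * Q * ι ((2 ℕ.* suc n) !)                                         ≡⟨ cong (ρ n * Q *_) (ι-[2n]! n) ⟩
    ρ n * Q * ((1ℚ + (1ℚ + ι 2 * ι n)) * ((1ℚ + ι 2 * ι n) * f))          ≡⟨ regroup (ι n) (ρ n) Q f ⟩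
    (½ + ι n) * ρ n * (ι 4 * (1ℚ + ι n) * (Q * f))                        ≡⟨ cong₂ (λ x y → x * (ι 4 * (1ℚ + ι n) * y)) (ρ-inverse n) (q₁-factorial n) ⟩
    1ℚ * (ι 4 * (1ℚ + ι n) * (ι (4 ^ n) * ι (n !)))                       ≡⟨ rearrange (ι n) (ι (4 ^ n)) (ι (n !)) ⟩
    ι 4 * ι (4 ^ n) * ((1ℚ + ι n) * ι (n !))                              ≡⟨ cong₂ _*_ (ι-4^ n) (ι-! n) ⟨
    ι (4 ^ suc n) * ι (suc n !)                                           ∎
    where
    open ≡-Reasoning
    Q f : ℚ
    Q = T₁.q n 0 0
    f = ι ((2 ℕ.* n) !)
    regroup : ∀ n r Q f → r * Q * ((1ℚ + (1ℚ + ι 2 * n)) * ((1ℚ + ι 2 * n) * f)) ≡ (½ + n) * r * (ι 4 * (1ℚ + n) * (Q * f))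
    regroup = solve-∀ ring
    rearrange : ∀ n x y → 1ℚ * (ι 4 * (1ℚ + n) * (x * y)) ≡ ι 4 * x * ((1ℚ + n) * y)
    rearrange = solve-∀ ring

  p₂-factorial : ∀ n → T₂.p n 0 * (ι (4 ^ n) * ι (n !)) ≡ ι ((2 ℕ.* n) !)
  p₂-factorial zero    = refl
  p₂-factorial (suc n) = begin
    (ι n + ½) * P * (ι (4 ^ suc n) * ι (suc n !))                                 ≡⟨ cong₂ (λ x y → (ι n + ½) * P * (x * y)) (ι-4^ n) (ι-! n) ⟩
    (ι n + ½) * P * (ι 4 * ι (4 ^ n) * ((1ℚ + ι n) * ι (n !)))                    ≡⟨ regroup (ι n) P (ι (4 ^ n)) (ι (n !)) ⟩
    (1ℚ + (1ℚ + ι 2 * ι n)) * ((1ℚ + ι 2 * ι n) * (P * (ι (4 ^ n) * ι (n !))))    ≡⟨ cong (λ x → (1ℚ + (1ℚ + ι 2 * ι n)) * ((1ℚ + ι 2 * ι n) * x)) (p₂-factorial n) ⟩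
    (1ℚ + (1ℚ + ι 2 * ι n)) * ((1ℚ + ι 2 * ι n) * ι ((2 ℕ.* n) !))                ≡⟨ ι-[2n]! n ⟨
    ι ((2 ℕ.* suc n) !)                                                           ∎
    where
    open ≡-Reasoning
    P : ℚ
    P = T₂.p n 0
    regroup : ∀ n P x y → (n + ½) * P * (ι 4 * x * ((1ℚ + n) * y)) ≡ (1ℚ + (1ℚ + ι 2 * n)) * ((1ℚ + ι 2 * n) * (P * (x * y)))
    regroup = solve-∀ ring

  q₂-factorial : ∀ n → T₂.q n 0 0 * ι (n !) ≡ 1ℚ
  q₂-factorial zero    = refl
  q₂-factorial (suc n) = begin
    inv (suc n) * R * ι (suc n !)                    ≡⟨ cong (inv (suc n) * R *_) (ι-* (suc n) (n !)) ⟩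
    inv (suc n) * R * (ι (suc n) * ι (n !))          ≡⟨ interchange (inv (suc n)) R (ι (suc n)) (ι (n !)) ⟩
    ι (suc n) * inv (suc n) * (R * ι (n !))          ≡⟨ cong₂ _*_ (ι*inv n) (q₂-factorial n) ⟩
    1ℚ                                               ∎
    where
    open ≡-Reasoning
    R : ℚ
    R = T₂.q n 0 0
    interchange : ∀ i R n f → i * R * (n * f) ≡ n * i * (R * f)
    interchange = solve-∀ ring

  ι-2nCn : ∀ n → ι ((2 ℕ.* n) C n) * (ι (n !) * ι (n !)) ≡ ι ((2 ℕ.* n) !)
  ι-2nCn n = trans (cong (ι ((2 ℕ.* n) C n) *_) (sym (ι-* (n !) (n !))))
    (trans (sym (ι-* ((2 ℕ.* n) C n) (n ! ℕ.* n !))) (cong ι (2nCn*n!*n!≡[2n]! n)))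

  -- This is n!/(1/2)_n. Both sides are multiplied by the positive C(2n,n) · n!, which reduces the
  -- claim to the factorial identities.
  q₁-central : ∀ n → ι (n !) * T₁.q n 0 0 ≡ ι (4 ^ n) * inv ((2 ℕ.* n) C n)
  q₁-central n = *-cancel-≡ {B * f} (*-pos (0<ι-pos ((2 ℕ.* n) C n) (1≤2nCn n)) (0<ι-pos (n !) (1≤n! n))) (begin
    B * f * (f * Q)                ≡⟨ regroup B f Q ⟩
    Q * (B * (f * f))              ≡⟨ cong (Q *_) (ι-2nCn n) ⟩
    Q * ι ((2 ℕ.* n) !)            ≡⟨ q₁-factorial n ⟩
    ι (4 ^ n) * f                  ≡⟨ *-identityˡ (ι (4 ^ n) * f) ⟨
    1ℚ * (ι (4 ^ n) * f)           ≡⟨ cong (_* (ι (4 ^ n) * f)) (ι*inv-pos ((2 ℕ.* n) C n) (1≤2nCn n)) ⟨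
    B * i * (ι (4 ^ n) * f)        ≡⟨ rearrange B i (ι (4 ^ n)) f ⟩
    B * f * (ι (4 ^ n) * i)        ∎)
    where
    open ≡-Reasoning
    B f Q i : ℚ
    B = ι ((2 ℕ.* n) C n)
    f = ι (n !)
    Q = T₁.q n 0 0
    i = inv ((2 ℕ.* n) C n)
    regroup : ∀ B f Q → B * f * (f * Q) ≡ Q * (B * (f * f))
    regroup = solve-∀ ring
    rearrange : ∀ B i x f → B * i * (x * f) ≡ B * f * (x * i)
    rearrange = solve-∀ ring

  p₂q₂-central : ∀ n → T₂.p n 0 * T₂.q n 0 0 ≡ inv (4 ^ n) * ι ((2 ℕ.* n) C n)
  p₂q₂-central n = *-cancel-≡ {x * (f * f)} (*-pos (0<ι-pos (4 ^ n) 1≤4^n) (*-pos 0<f 0<f)) (begin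
    x * (f * f) * (P * R)          ≡⟨ regroup x f P R ⟩
    P * (x * f) * (R * f)          ≡⟨ cong₂ _*_ (p₂-factorial n) (q₂-factorial n) ⟩
    ι ((2 ℕ.* n) !) * 1ℚ           ≡⟨ cong₂ _*_ (ι-2nCn n) (ι*inv-pos (4 ^ n) 1≤4^n) ⟨
    B * (f * f) * (x * i)          ≡⟨ rearrange B (f * f) x i ⟩
    x * (f * f) * (i * B)          ∎)
    where
    open ≡-Reasoning
    B f P R x i : ℚ
    B = ι ((2 ℕ.* n) C n)
    f = ι (n !)
    P = T₂.p n 0
    R = T₂.q n 0 0
    x = ι (4 ^ n)
    i = inv (4 ^ n)
    1≤4^n : 1 ℕ.≤ 4 ^ n
    1≤4^n = ℕₚ.m^n>0 4 n
    0<f : 0ℚ < f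
    0<f = 0<ι-pos (n !) (1≤n! n)
    regroup : ∀ x f P R → x * (f * f) * (P * R) ≡ P * (x * f) * (R * f)
    regroup = solve-∀ ring
    rearrange : ∀ B y x i → B * y * (x * i) ≡ x * y * (i * B)
    rearrange = solve-∀ ring

  -- `p₁-ζ` yields only (N - 1)! for N = n + 1, while `q₁-central` contains N!. The missing factor N
  -- turns the 1/N of `F` into 1/N², and the same shift produces ζ at N - 1.
  F₁-term : ∀ n m k → ι (4 ^ suc n) * inv ((2 ℕ.* suc n) C suc n) * (ζₙ m n * t⋆ₙ k (suc n)) * inv (suc n ^ 2)
    ≡ T₁.F (suc n) 0 (suc m) k
  F₁-term n m k = begin
    ι (4 ^ N) * inv ((2 ℕ.* N) C N) * (z * t) * inv (N ^ 2)
      ≡⟨ cong₂ (λ x y → x * (z * t) * y) (trans (sym (q₁-central N)) (cong (_* Q) (ι-* N (n !))))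
           (trans (inv-* N (N ^ 1)) (cong (λ j → inv N * inv j) (ℕₚ.*-identityʳ N))) ⟩
    ι N * ι (n !) * Q * (z * t) * (inv N * inv N)
      ≡⟨ regroup (ι N) (ι (n !)) Q z t (inv N) ⟩
    ι N * inv N * (ι (n !) * z * (Q * t) * inv N)
      ≡⟨ trans (cong (_* (ι (n !) * z * (Q * t) * inv N)) (ι*inv n)) (*-identityˡ (ι (n !) * z * (Q * t) * inv N)) ⟩
    ι (n !) * z * (Q * t) * inv N
      ≡⟨ cong₂ (λ x y → x * y * inv N) (p₁-ζ n m) (q₁-t⋆ N k) ⟨
    T₁.p N (suc m) * T₁.q N 0 k * inv N ∎
    where
    open ≡-Reasoning
    N : ℕ
    N = suc n
    z t Q : ℚ
    z = ζₙ m n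
    t = t⋆ₙ k N
    Q = T₁.q N 0 0
    regroup : ∀ N f Q z t i → N * f * Q * (z * t) * (i * i) ≡ N * i * (f * z * (Q * t) * i)
    regroup = solve-∀ ring

  F₂-term : ∀ n m k → inv (4 ^ n) * ι ((2 ℕ.* n) C n) * (tₙ k n * ζ⋆ₙ m n) * inv n ≡ T₂.F n 0 k m
  F₂-term n m k = begin
    inv (4 ^ n) * ι ((2 ℕ.* n) C n) * (tₙ k n * ζ⋆ₙ m n) * inv n      ≡⟨ cong (λ x → x * (tₙ k n * ζ⋆ₙ m n) * inv n) (p₂q₂-central n) ⟨
    T₂.p n 0 * T₂.q n 0 0 * (tₙ k n * ζ⋆ₙ m n) * inv n                ≡⟨ interchange (T₂.p n 0) (T₂.q n 0 0) (tₙ k n) (ζ⋆ₙ m n) (inv n) ⟩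
    T₂.p n 0 * tₙ k n * (T₂.q n 0 0 * ζ⋆ₙ m n) * inv n                ≡⟨ cong₂ (λ x y → x * y * inv n) (p₂-t n k) (q₂-ζ⋆ n m) ⟨
    T₂.p n k * T₂.q n 0 m * inv n                                     ∎
    where
    open ≡-Reasoning
    interchange : ∀ P Q t z i → P * Q * (t * z) * i ≡ P * t * (Q * z) * i
    interchange = solve-∀ ring

  -- Evaluation of the two series

  W₁-value : ∀ m k → T₁.W m k ≡ ι ((m ℕ.+ k) C k) * inv (2 ^ k)
  W₁-value m k = trans (T₁.W-binomial m k) (cong₂ _*_ (cong ι ([m+n]Cm≡[m+n]Cn m k))
    (trans (cong₂ _*_ (pow-1 m) (pow-½ k)) (*-identityˡ (inv (2 ^ k)))))

  W₂-value : ∀ k m → T₂.W k m ≡ ι ((m ℕ.+ k) C k) * inv (2 ^ k)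
  W₂-value k m = trans (T₂.W-binomial k m) (cong₂ _*_ (cong (λ j → ι (j C k)) (ℕₚ.+-comm k m))
    (trans (cong₂ _*_ (pow-½ k) (pow-1 m)) (*-identityʳ (inv (2 ^ k)))))

  *-swapʳ : ∀ x y z → x * y * z ≡ x * z * y
  *-swapʳ = solve-∀ ring

  first-series : ∀ m k → let s = suc m ℕ.+ k ℕ.+ 1 in
    SeriesEqζ (λ n → ι (4 ^ n) * inv ((2 ℕ.* n) C n) * (ζₙ m (n ∸ 1) * t⋆ₙ k n) * inv (n ^ 2))
              (ι ((suc m ℕ.+ k) C k) * ι (2 ^ s ∸ 1) * inv (2 ^ k)) s
  first-series m k = SeriesEqζ-cong (λ n → F₁-term n m k)
    (trans (*-swapʳ (ι ((suc m ℕ.+ k) C k)) (ι (2 ^ s ∸ 1)) (inv (2 ^ k))) (cong (_* ι (2 ^ s ∸ 1)) (sym (W₁-value (suc m) k))))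
    (refl {x = s}) (T₁.F-series m k)
    where
    s : ℕ
    s = suc m ℕ.+ k ℕ.+ 1

  -- Only the X-index has to be positive, and in `T₂` it marks k. Hence m = 0 is included, and
  -- `second-series₀` is that instance.
  second-series : ∀ m k → let s = m ℕ.+ suc k ℕ.+ 1 in
    SeriesEqζ (λ n → inv (4 ^ n) * ι ((2 ℕ.* n) C n) * (tₙ (suc k) n * ζ⋆ₙ m n) * inv n)
              (ι ((m ℕ.+ suc k) C suc k) * ι (2 ^ s ∸ 1) * inv (2 ^ suc k)) s
  second-series m k = SeriesEqζ-cong (λ n → F₂-term (suc n) m (suc k))
    (trans (*-swapʳ (ι ((m ℕ.+ suc k) C suc k)) (ι (2 ^ s ∸ 1)) (inv (2 ^ suc k)))
      (cong₂ _*_ (sym (W₂-value (suc k) m)) (cong (λ j → ι (2 ^ j ∸ 1)) s≡)))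
    s≡ (T₂.F-series k m)
    where
    s : ℕ
    s = m ℕ.+ suc k ℕ.+ 1
    s≡ : s ≡ suc k ℕ.+ m ℕ.+ 1
    s≡ = cong (ℕ._+ 1) (ℕₚ.+-comm m (suc k))

  second-series₀ : ∀ k → SeriesEqζ (λ n → inv (4 ^ n) * ι ((2 ℕ.* n) C n) * tₙ (suc k) n * inv n)
    (ι (2 ^ (suc k ℕ.+ 1) ∸ 1) * inv (2 ^ suc k)) (suc k ℕ.+ 1)
  second-series₀ k = SeriesEqζ-cong
    (λ n → cong (_* inv (suc n)) (insert (inv (4 ^ suc n) * ι ((2 ℕ.* suc n) C suc n)) (tₙ (suc k) (suc n))))
    (cong (_* inv (2 ^ suc k)) (trans (sym (*-identityˡ (ι (2 ^ (suc k ℕ.+ 1) ∸ 1))))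
      (cong (λ j → ι j * ι (2 ^ (suc k ℕ.+ 1) ∸ 1)) (sym (nCn≡1 (suc k))))))
    (refl {x = suc k ℕ.+ 1}) (second-series 0 k)
    where
    insert : ∀ x t → x * t ≡ x * (t * 1ℚ)
    insert = solve-∀ ring

open RationalSeries using (first-series; second-series; second-series₀)
open import Data.Nat as ℕ using (ℕ; suc; _≤_; _+_; _∸_; _^_)
open import Data.Nat.Combinatorics using (_C_)
open import Data.Rational using (_*_)
open import Data.Product using (_×_; _,_)

theorem7p1 : (∀ (m k : ℕ) → 1 ≤ m → 1 ≤ k →
    let c = ℕ→ℚ ((m + k) C k) * ℕ→ℚ (2 ^ (m + k + 1) ∸ 1) * inv (2 ^ k) in
    SeriesEqζ (λ n → ℕ→ℚ (4 ^ n) * inv ((2 ℕ.* n) C n)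
    * (ζₙ (m ∸ 1) (n ∸ 1) * t⋆ₙ k n) * inv (n ^ 2))
    c (m + k + 1)
    × SeriesEqζ (λ n → inv (4 ^ n) * ℕ→ℚ ((2 ℕ.* n) C n)
    * (tₙ k n * ζ⋆ₙ m n) * inv n)
    c (m + k + 1))
    × (∀ (k : ℕ) → 1 ≤ k →
    SeriesEqζ (λ n → inv (4 ^ n) * ℕ→ℚ ((2 ℕ.* n) C n) * tₙ k n * inv n)
    (ℕ→ℚ (2 ^ (k + 1) ∸ 1) * inv (2 ^ k)) (k + 1))
theorem7p1 = (λ { (suc m) (suc k) _ _ → first-series m (suc k) , second-series (suc m) k })
           , (λ { (suc k) _ → second-series₀ k })
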